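{- Let $\mathbf A$ be a finite solvable Malcev algebra. Then there exists a sequence of primes $p_1,\dots,p_h$ such that $\mathrm{nuP}_{\mathbf A}\subseteq\mathrm{nuDet}_{p_1}\circ\dots\circ\mathrm{nuDet}_{p_h}$.
   Context: An ABP over $\mathrm{GF}(p)$ is a DAG with one source and one sink, edges labelled by variables or constants; it computes the sum over source-sink paths of products of labels; size = vertices plus edges. A $\mathrm{BABP}_p$ gate is labelled by an ABP over $\mathrm{GF}(p)$ and a set $T\subseteq\mathrm{GF}(p)$, outputs 1 iff the polynomial evaluated on its Boolean inputs is in $T$, and has the size of its ABP. $\mathrm{nuDet}_{p_1}\circ\dots\circ\mathrm{nuDet}_{p_h}$ is the class of languages recognized by polynomial-size layered circuit families whose output gate is a $\mathrm{BABP}_{p_1}$ gate, whose inputs are outputs of $\mathrm{BABP}_{p_2}$ gates, ..., down to $\mathrm{BABP}_{p_h}$ gates reading the input bits (size of a circuit = number of edges plus the sum of gate sizes). For a finite algebra $\mathbf A$, $\mathrm{nuP}_{\mathbf A}$ is the class of languages over $\{0,1\}$ recognized by NuDFAs $((t_n),\iota,S)$ with $t_n$ $n$-input circuits over $\mathbf A$ (sources variables or constants, gates basic operations) of polynomially bounded size, $\iota:\{0,1\}\to A$, $S\subseteq A$, accepting $b$ iff $t_n(\iota(b_1),\dots,\iota(b_n))\in S$. Malcev: has a term $d$ with $d(x,y,y)=d(y,y,x)=x$; solvable in the commutator-theory sense. -}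

module Defs where

open import Data.Nat using (ℕ; zero; suc; _+_; _*_; _^_; _≤_; _<_; NonZero)
open import Data.Nat.DivMod using (_mod_)
open import Data.Fin using (Fin; zero; suc; toℕ; fromℕ; _≟_)
open import Data.Bool using (Bool; true; false; T; if_then_else_; _∧_)
open import Data.List using (List; []; _∷_; map; concatMap; foldr; allFin; upTo)
open import Data.Vec using (Vec; lookup) renaming ([] to []ᵛ; _∷_ to _∷ᵛ_)
open import Data.Sum using (_⊎_; [_,_])
open import Data.Product using (Σ; ∃; _×_; _,_; proj₁; proj₂)
open import Data.Unit using (⊤)
open import Relation.Nullary using (¬_)
open import Relation.Nullary.Decidable using (⌊_⌋)
open import Relation.Binary.PropositionalEquality using (_≡_; _≢_)
open import Function.Bundles using (_⇔_)

PolyBounded : (ℕ → ℕ) → Set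
PolyBounded f = ∃ λ c → ∀ n → f n ≤ c * n ^ c + c

sumFin : (w : ℕ) → (Fin w → ℕ) → ℕ
sumFin zero    f = 0
sumFin (suc w) f = f zero + sumFin w (λ i → f (suc i))

Lang : Set₁
Lang = (n : ℕ) → (Fin n → Bool) → Set

record FinAlgebra : Set where
  field
    k     : ℕ
    nOps  : ℕ
    arity : Fin nOps → ℕ
    op    : (f : Fin nOps) → (Fin (arity f) → Fin k) → Fin k

module _ (A : FinAlgebra) where
  open FinAlgebra A

  data Term (V : Set) : Set where
    var : V → Term V
    app : (f : Fin nOps) → (Fin (arity f) → Term V) → Term V

  evalTerm : {V : Set} → Term V → (V → Fin k) → Fin k
  evalTerm (var x)    env = env x
  evalTerm (app f ts) env = op f (λ i → evalTerm (ts i) env)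

  IsMalcev : Set
  IsMalcev = Σ (Term (Fin 3)) λ d → ∀ x y →
      (evalTerm d (lookup (x ∷ᵛ y ∷ᵛ y ∷ᵛ []ᵛ)) ≡ x)
    × (evalTerm d (lookup (y ∷ᵛ y ∷ᵛ x ∷ᵛ []ᵛ)) ≡ x)

  Rel : Set₁
  Rel = Fin k → Fin k → Set

  -- (Boolean-valued) congruences: every binary relation on the finite set Fin k
  IsCong : (Fin k → Fin k → Bool) → Set
  IsCong δ =
      (∀ x → T (δ x x))
    × (∀ x y → T (δ x y) → T (δ y x))
    × (∀ x y z → T (δ x y) → T (δ y z) → T (δ x z))
    × (∀ f (a b : Fin (arity f) → Fin k) →
         (∀ i → T (δ (a i) (b i))) → T (δ (op f a) (op f b)))

  TC : Rel → Rel → (Fin k → Fin k → Bool) → Set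
  TC α β δ = ∀ (m n : ℕ) (t : Term (Fin m ⊎ Fin n))
    (a b : Fin m → Fin k) (c d : Fin n → Fin k) →
    (∀ i → α (a i) (b i)) → (∀ j → β (c j) (d j)) →
    T (δ (evalTerm t [ a , c ]) (evalTerm t [ a , d ])) →
    T (δ (evalTerm t [ b , c ]) (evalTerm t [ b , d ]))

  Comm : Rel → Rel → Rel
  Comm α β x y = ∀ δ → IsCong δ → TC α β δ → T (δ x y)

  derived : ℕ → Rel
  derived zero    x y = ⊤
  derived (suc n) = Comm (derived n) (derived n)

  IsSolvable : Set
  IsSolvable = ∃ λ n → ∀ x y → derived n x y → x ≡ y

  -- circuits over A: a list of nodes, each referring to earlier nodes;
  -- Circ n s has s nodes; index zero is the most recently added node
  data Node (n s : ℕ) : Set where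
    input : Fin n → Node n s
    const : Fin k → Node n s
    gate  : (f : Fin nOps) → (Fin (arity f) → Fin s) → Node n s

  data Circ (n : ℕ) : ℕ → Set where
    nil  : Circ n 0
    snoc : ∀ {s} → Circ n s → Node n s → Circ n (suc s)

  evalNode : ∀ {n s} → Node n s → (Fin n → Fin k) → (Fin s → Fin k) → Fin k
  evalNode (input i)  env val = env i
  evalNode (const c)  env val = c
  evalNode (gate f g) env val = op f (λ j → val (g j))

  evalCirc : ∀ {n s} → Circ n s → (Fin n → Fin k) → Fin s → Fin k
  evalCirc (snoc C nd) env zero    = evalNode nd env (evalCirc C env)
  evalCirc (snoc C nd) env (suc i) = evalCirc C env i

  -- nuP_A: NuDFAs ((t_n), ι, S); t_n has (suc s) nodes (its size), output node zero
  InNuP : Lang → Set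
  InNuP L =
    Σ ((n : ℕ) → Σ ℕ λ s → Circ n (suc s)) λ t →
    Σ (Bool → Fin k) λ ι →
    Σ (Fin k → Bool) λ S →
      PolyBounded (λ n → suc (proj₁ (t n)))
    × (∀ n (b : Fin n → Bool) →
         L n b ⇔ T (S (evalCirc (proj₂ (t n)) (λ i → ι (b i)) zero)))

-- GF(p) arithmetic on Fin p (p a nonzero modulus; used with p prime)

module GF (p : ℕ) .{{_ : NonZero p}} where
  _+ₚ_ : Fin p → Fin p → Fin p
  a +ₚ b = (toℕ a + toℕ b) mod p

  _*ₚ_ : Fin p → Fin p → Fin p
  a *ₚ b = (toℕ a * toℕ b) mod p

  0ₚ 1ₚ : Fin p
  0ₚ = 0 mod p
  1ₚ = 1 mod p

-- Algebraic branching programs over GF(p) with n variables.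
-- Vertices Fin (suc m), listed in a topological order (every edge goes
-- from a smaller to a larger vertex, so the graph is a DAG);
-- the source is vertex zero and the sink is vertex fromℕ m.

data Label (p n : ℕ) : Set where
  var : Fin n → Label p n
  cst : Fin p → Label p n

record ABP (p n : ℕ) : Set where
  field
    m     : ℕ
    E     : ℕ
    src   : Fin E → Fin (suc m)
    tgt   : Fin E → Fin (suc m)
    lab   : Fin E → Label p n
    acyclic  : ∀ e → toℕ (src e) < toℕ (tgt e)
    oneSource : ∀ v → v ≢ zero → ∃ λ e → tgt e ≡ v
    oneSink   : ∀ v → v ≢ fromℕ m → ∃ λ e → src e ≡ v

  source sink : Fin (suc m)
  source = zero
  sink   = fromℕ m

  isPathFrom : Fin (suc m) → List (Fin E) → Bool
  isPathFrom v []       = ⌊ v ≟ sink ⌋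
  isPathFrom v (e ∷ es) = ⌊ src e ≟ v ⌋ ∧ isPathFrom (tgt e) es

abpSize : ∀ {p n} → ABP p n → ℕ
abpSize P = suc (ABP.m P) + ABP.E P

allLists : (E L : ℕ) → List (List (Fin E))
allLists E zero    = [] ∷ []
allLists E (suc L) = concatMap (λ e → map (e ∷_) (allLists E L)) (allFin E)

module _ {p n : ℕ} .{{_ : NonZero p}} where
  open GF p

  evalLabel : Label p n → (Fin n → Bool) → Fin p
  evalLabel (var i) x = if x i then 1ₚ else 0ₚ
  evalLabel (cst c) x = c

  -- value of the ABP on Boolean inputs: sum over all source–sink paths
  -- (every path of a DAG on suc m vertices has at most m edges)
  evalABP : ABP p n → (Fin n → Bool) → Fin p
  evalABP P x =
    foldr _+ₚ_ 0ₚ (concatMap (λ L → map pathValue (allLists E L)) (upTo (suc m)))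
    where
      open ABP P
      pathValue : List (Fin E) → Fin p
      pathValue es = if isPathFrom source es
                       then foldr (λ e r → evalLabel (lab e) x *ₚ r) 1ₚ es
                       else 0ₚ

-- BABP_p gates with r inputs, wired to r of the w gates of the next layer

record Gate (p w : ℕ) : Set where
  field
    {{nz}} : NonZero p
    r     : ℕ
    wire  : Fin r → Fin w
    abp   : ABP p r
    acc   : Fin p → Bool

gateOut : ∀ {p w} → Gate p w → (Fin w → Bool) → Bool
gateOut G v = acc (evalABP abp (λ j → v (wire j)))
  where open Gate G

gateSize : ∀ {p w} → Gate p w → ℕ
gateSize G = Gate.r G + abpSize (Gate.abp G)

-- Layered circuits of BABP gates on n input bits.
-- Net n (p₁ ∷ … ∷ p_h) w : top layer has w BABP_{p₁} gates, …,
-- bottom layer consists of BABP_{p_h} gates reading the input bits.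
data Net (n : ℕ) : List ℕ → ℕ → Set where
  bottom : ∀ {p w} → (Fin w → Gate p n) → Net n (p ∷ []) w
  layer  : ∀ {p q ps w w'} → (Fin w → Gate p w') → Net n (q ∷ ps) w' →
           Net n (p ∷ q ∷ ps) w

evalNet : ∀ {n ps w} → Net n ps w → (Fin n → Bool) → Fin w → Bool
evalNet (bottom gs)  x i = gateOut (gs i) x
evalNet (layer gs N) x i = gateOut (gs i) (evalNet N x)

netSize : ∀ {n ps w} → Net n ps w → ℕ
netSize {w = w} (bottom gs)  = sumFin w (λ i → gateSize (gs i))
netSize {w = w} (layer gs N) = sumFin w (λ i → gateSize (gs i)) + netSize N

InNuDet : List ℕ → Lang → Set
InNuDet ps L =
  Σ ((n : ℕ) → Net n ps 1) λ C →
    PolyBounded (λ n → netSize (C n))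
  × (∀ n (b : Fin n → Bool) → L n b ⇔ T (evalNet (C n) b zero))

{-# OPTIONS --safe #-}

-- The algebra has a chain of congruences from the full relation down to equality in which every step
-- β ⊆ α is abelian and p-torsion for a prime p: on a block of α, the operation x + y = d(x, e, y) is,
-- modulo β, an abelian group of exponent p, and the basic operations are affine maps between blocks.
-- Suppose the values of all nodes of a circuit modulo α are known. The value of a node modulo β is then a
-- ℤ-combination of the elements of its block, and at a gate the coefficients are sums of coefficients of
-- its arguments, selected by the known blocks. So a branching program over GF(p) computes all
-- coefficients modulo p, which is enough because p kills the blocks, and one more layer of gates decodes
-- them into values modulo β. At the end of the chain the values themselves are known.

module Submission where

open import Defs
open import Algebra using (CommutativeMonoid)
import Algebra.Properties.CommutativeMonoid.Mult
import Algebra.Properties.CommutativeMonoid.Sum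
open import Data.Bool using (Bool; true; false; T; if_then_else_; _∧_)
open import Data.Bool.Properties using (T?; T-∧)
open import Data.Empty using (⊥; ⊥-elim)
open import Data.Fin using (Fin; zero; suc; toℕ; fromℕ; _≟_; combine; remQuot; join; splitAt)
open import Data.Fin.Properties using (toℕ-fromℕ<; toℕ-injective; toℕ<n; toℕ≤pred[n]; all?; any?; pigeonhole; remQuot-combine; combine-remQuot; splitAt-join)
open import Data.Fin.Subset using (Subset; _∈_; _⊃_)
open import Data.Fin.Subset.Induction using (⊃-wellFounded; Acc; acc)
open import Data.List as List using (List; []; _∷_; _++_; map; concatMap; foldr; allFin; upTo; length; applyUpTo)
open import Data.List.Membership.Propositional using () renaming (_∈_ to _∈ˡ_)
open import Data.List.Membership.Propositional.Properties using (∈-map⁺; ∈-++⁺ˡ; ∈-++⁺ʳ; ∈-allFin; ∈-lookup)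
open import Data.List.Properties using (map-++; map-tabulate; tabulate-lookup; length-++; length-map; length-tabulate; map-upTo)
open import Data.List.Relation.Unary.All as All using (All; []; _∷_)
import Data.List.Relation.Unary.All.Properties as All
open import Data.List.Relation.Unary.Any using (there; index)
open import Data.List.Relation.Unary.Any.Properties using (lookup-index)
open import Data.Nat as ℕ using (ℕ; zero; suc; _+_; _*_; _∸_; _^_; _%_; _/_; _≤_; _<_; z≤n; s≤s; NonZero; >-nonZero; >-nonZero⁻¹; nonTrivial⇒n>1)
open import Data.Nat.DivMod using (_mod_; %-distribˡ-+; %-distribˡ-*; m<n⇒m%n≡m; m≡m%n+[m/n]*n)
open import Data.Nat.ListAction using (product)
open import Data.Nat.Primality using (Prime; prime[2]; prime⇒nonZero; prime⇒nonTrivial)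
open import Data.Nat.Primality.Factorisation using (factorise; PrimeFactorisation)
open import Data.Nat.Properties hiding (_≟_)
open import Data.Nat.Solver using (module +-*-Solver)
open import Data.Product using (Σ; ∃; _×_; _,_; proj₁; proj₂; uncurry; map₁; map₂)
open import Data.Sum as Sum using (_⊎_; inj₁; inj₂; [_,_])
open import Data.Unit using (⊤; tt)
open import Data.Vec as Vec using (Vec; lookup; tabulate) renaming ([] to []ᵛ; _∷_ to _∷ᵛ_)
open import Data.Vec.Functional as Vector using ()
open import Data.Vec.Properties using (lookup∘tabulate; []=⇒lookup; lookup⇒[]=)
open import Function using (_∘_; id)
open import Function.Bundles using (_⇔_; Equivalence)
open import Level using (0ℓ)
open import Relation.Binary using (IsEquivalence; Setoid)
open import Relation.Binary.PropositionalEquality using (_≡_; _≢_; _≗_; refl; sym; trans; cong; cong₂; subst; subst₂; module ≡-Reasoning)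
open import Relation.Nullary using (¬_; Dec; yes; no; contradiction)
open import Relation.Nullary.Decidable using (⌊_⌋; map′; _×-dec_; _→-dec_; ¬?; toWitness; fromWitness; decidable-stable)

-- Path sums of branching programs

-- Circuits share subcircuits, so the integer coefficients of a node can be exponentially large and
-- collect exponentially many paths. Counting weighted paths modulo p is exactly what a branching
-- program does, provided that no two coefficients are ever multiplied. This is why operations are
-- linearised: on a product of blocks an operation is a constant plus a sum of unary linear maps,
-- and a linear map merely redistributes coefficients over the generators. Which maps occur depends
-- on the blocks of the arguments. These are bits delivered by earlier layers, and bits may label
-- edges; since the algebra does not grow with n, a decision tree of constant size makes the
-- selection.
--
-- Decoding and acceptance only manipulate bits, for which any prime would do. The prime 2 is taken,
-- so the sequence interleaves the torsion primes with 2s.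
--
-- A second obstacle is that `derived` is defined by intersecting over all congruences that satisfy
-- a condition on all terms. The chain needs Boolean relations, so the term condition is replaced by
-- one equation per basic operation, which exhaustive search can decide.

sumOver : {A : Set} → (A → ℕ) → List A → ℕ
sumOver f []       = 0
sumOver f (x ∷ xs) = f x + sumOver f xs

module _ {A : Set} where

  sumOver-cong : {f g : A → ℕ} → (∀ x → f x ≡ g x) → ∀ xs → sumOver f xs ≡ sumOver g xs
  sumOver-cong f≗g []       = refl
  sumOver-cong f≗g (x ∷ xs) = cong₂ _+_ (f≗g x) (sumOver-cong f≗g xs)

  sumOver-++ : (f : A → ℕ) → ∀ xs ys → sumOver f (xs ++ ys) ≡ sumOver f xs + sumOver f ys
  sumOver-++ f []       ys = refl
  sumOver-++ f (x ∷ xs) ys =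
    trans (cong (f x +_) (sumOver-++ f xs ys)) (sym (+-assoc (f x) _ _))

  sumOver-0 : ∀ xs → sumOver {A} (λ _ → 0) xs ≡ 0
  sumOver-0 []       = refl
  sumOver-0 (x ∷ xs) = sumOver-0 xs

  sumOver-+ : (f g : A → ℕ) → ∀ xs → sumOver (λ x → f x + g x) xs ≡ sumOver f xs + sumOver g xs
  sumOver-+ f g []       = refl
  sumOver-+ f g (x ∷ xs) = begin
    f x + g x + sumOver (λ x → f x + g x) xs   ≡⟨ cong (f x + g x +_) (sumOver-+ f g xs) ⟩
    f x + g x + (sumOver f xs + sumOver g xs)  ≡⟨ solve 4 (λ a b c d → a :+ b :+ (c :+ d) := a :+ c :+ (b :+ d)) refl (f x) (g x) _ _ ⟩
    f x + sumOver f xs + (g x + sumOver g xs)  ∎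
    where
    open ≡-Reasoning
    open +-*-Solver

  sumOver-* : (c : ℕ) (f : A → ℕ) → ∀ xs → sumOver (λ x → c * f x) xs ≡ c * sumOver f xs
  sumOver-* c f []       = sym (*-zeroʳ c)
  sumOver-* c f (x ∷ xs) =
    trans (cong (c * f x +_) (sumOver-* c f xs)) (sym (*-distribˡ-+ c (f x) _))

module _ {A B : Set} where

  sumOver-map : (f : B → ℕ) (h : A → B) → ∀ xs → sumOver f (map h xs) ≡ sumOver (f ∘ h) xs
  sumOver-map f h []       = refl
  sumOver-map f h (x ∷ xs) = cong (f (h x) +_) (sumOver-map f h xs)

  sumOver-concatMap : (f : B → ℕ) (h : A → List B) → ∀ xs →
    sumOver f (concatMap h xs) ≡ sumOver (λ a → sumOver f (h a)) xs
  sumOver-concatMap f h []       = refl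
  sumOver-concatMap f h (x ∷ xs) =
    trans (sumOver-++ f (h x) _) (cong (sumOver f (h x) +_) (sumOver-concatMap f h xs))

  sumOver-swap : (f : A → B → ℕ) → ∀ xs ys →
    sumOver (λ a → sumOver (f a) ys) xs ≡ sumOver (λ b → sumOver (λ a → f a b) xs) ys
  sumOver-swap f []       ys = sym (sumOver-0 ys)
  sumOver-swap f (x ∷ xs) ys =
    trans (cong (sumOver (f x) ys +_) (sumOver-swap f xs ys)) (sym (sumOver-+ (f x) _ ys))

sumOver-lookup : {A : Set} (f : A → ℕ) (xs : List A) →
  sumOver (f ∘ List.lookup xs) (allFin (length xs)) ≡ sumOver f xs
sumOver-lookup f xs = begin
  sumOver (f ∘ List.lookup xs) (allFin (length xs))      ≡⟨ sumOver-map f (List.lookup xs) (allFin (length xs)) ⟨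
  sumOver f (map (List.lookup xs) (List.tabulate id))         ≡⟨ cong (sumOver f) (map-tabulate id (List.lookup xs)) ⟩
  sumOver f (List.tabulate (List.lookup xs))                  ≡⟨ cong (sumOver f) (tabulate-lookup xs) ⟩
  sumOver f xs                                      ∎
  where open ≡-Reasoning

[_]? : Bool → ℕ
[ b ]? = if b then 1 else 0

≟-suc : ∀ {n} (i j : Fin n) → ⌊ suc i ≟ suc j ⌋ ≡ ⌊ i ≟ j ⌋
≟-suc i j with i ≟ j
... | yes _ = refl
... | no  _ = refl

module ModArith (p : ℕ) .{{_ : NonZero p}} where
  open GF p
  open ≡-Reasoning

  toℕ-mod : ∀ n → toℕ (n mod p) ≡ n % p
  toℕ-mod n = toℕ-fromℕ< _

  mod-toℕ : (c : Fin p) → c ≡ toℕ c mod p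
  mod-toℕ c = toℕ-injective (sym (trans (toℕ-mod (toℕ c)) (m<n⇒m%n≡m (toℕ<n c))))

  mod-+ : ∀ m n → (m mod p) +ₚ (n mod p) ≡ (m + n) mod p
  mod-+ m n = toℕ-injective (begin
    toℕ ((toℕ (m mod p) + toℕ (n mod p)) mod p)  ≡⟨ toℕ-mod _ ⟩
    (toℕ (m mod p) + toℕ (n mod p)) % p          ≡⟨ cong₂ (λ a b → (a + b) % p) (toℕ-mod m) (toℕ-mod n) ⟩
    (m % p + n % p) % p                          ≡⟨ %-distribˡ-+ m n p ⟨
    (m + n) % p                                  ≡⟨ toℕ-mod (m + n) ⟨
    toℕ ((m + n) mod p)                          ∎)

  mod-* : ∀ m n → (m mod p) *ₚ (n mod p) ≡ (m * n) mod p
  mod-* m n = toℕ-injective (begin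
    toℕ ((toℕ (m mod p) * toℕ (n mod p)) mod p)  ≡⟨ toℕ-mod _ ⟩
    (toℕ (m mod p) * toℕ (n mod p)) % p          ≡⟨ cong₂ (λ a b → (a * b) % p) (toℕ-mod m) (toℕ-mod n) ⟩
    (m % p * (n % p)) % p                        ≡⟨ %-distribˡ-* m n p ⟨
    (m * n) % p                                  ≡⟨ toℕ-mod (m * n) ⟨
    toℕ ((m * n) mod p)                          ∎)

  foldr-mod : {A : Set} (f : A → Fin p) (g : A → ℕ) → (∀ a → f a ≡ g a mod p) → ∀ xs →
    foldr _+ₚ_ 0ₚ (map f xs) ≡ sumOver g xs mod p
  foldr-mod f g eq []       = refl
  foldr-mod f g eq (x ∷ xs) = begin
    f x +ₚ foldr _+ₚ_ 0ₚ (map f xs)         ≡⟨ cong₂ _+ₚ_ (eq x) (foldr-mod f g eq xs) ⟩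
    (g x mod p) +ₚ (sumOver g xs mod p)     ≡⟨ mod-+ (g x) (sumOver g xs) ⟩
    (g x + sumOver g xs) mod p              ∎

-- Path sums are taken in ℕ, where the semiring laws are at hand; reduction modulo p happens once,
-- at the end.
labelℕ : ∀ {p n} → Label p n → (Fin n → Bool) → ℕ
labelℕ (var i) x = [ x i ]?
labelℕ (cst c) x = toℕ c

module _ {p n : ℕ} .{{_ : NonZero p}} where
  open GF p
  open ModArith p

  evalLabel≡ : (ℓ : Label p n) (x : Fin n → Bool) → evalLabel ℓ x ≡ labelℕ ℓ x mod p
  evalLabel≡ (var i) x with x i
  ... | true  = refl
  ... | false = refl
  evalLabel≡ (cst c) x = mod-toℕ c

concatMap-map : {A B C : Set} (f : B → C) (h : A → List B) → ∀ xs →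
  concatMap (map f ∘ h) xs ≡ map f (concatMap h xs)
concatMap-map f h []       = refl
concatMap-map f h (x ∷ xs) =
  trans (cong (map f (h x) ++_) (concatMap-map f h xs)) (sym (map-++ f (h x) _))

module PathSum {p n : ℕ} .{{_ : NonZero p}} (P : ABP p n) (x : Fin n → Bool) where
  open ABP P
  open GF p
  open ModArith p
  open ≡-Reasoning

  weight : List (Fin E) → ℕ
  weight = foldr (λ e r → labelℕ (lab e) x * r) 1

  pathWeight : Fin (suc m) → List (Fin E) → ℕ
  pathWeight v es = [ isPathFrom v es ]? * weight es

  weight-mod : ∀ es → foldr (λ e r → evalLabel (lab e) x *ₚ r) 1ₚ es ≡ weight es mod p
  weight-mod []       = refl
  weight-mod (e ∷ es) =
    trans (cong₂ _*ₚ_ (evalLabel≡ (lab e) x) (weight-mod es)) (mod-* (labelℕ (lab e) x) (weight es))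

  value-mod : ∀ es →
    (if isPathFrom source es then foldr (λ e r → evalLabel (lab e) x *ₚ r) 1ₚ es else 0ₚ)
      ≡ pathWeight source es mod p
  value-mod es with isPathFrom source es
  ... | true  = trans (weight-mod es) (cong (_mod p) (sym (*-identityˡ (weight es))))
  ... | false = refl

  lists : ℕ → List (List (Fin E))
  lists N = concatMap (allLists E) (upTo N)

  evalABP≡sum : evalABP P x ≡ sumOver (pathWeight source) (lists (suc m)) mod p
  evalABP≡sum =
    trans (cong (foldr _+ₚ_ 0ₚ) (concatMap-map _ (allLists E) (upTo (suc m))))
          (foldr-mod _ (pathWeight source) value-mod (lists (suc m)))

  -- A path from v is empty, if v is the sink, or starts with an edge leaving v. Acyclicity makes
  -- path sums the only fixed point of this operator.
  step : Fin (suc m) → (Fin (suc m) → ℕ) → ℕ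
  step v W = [ ⌊ v ≟ sink ⌋ ]? + sumOver (λ e → [ ⌊ src e ≟ v ⌋ ]? * (labelℕ (lab e) x * W (tgt e))) (allFin E)

  pathSum : ℕ → Fin (suc m) → ℕ
  pathSum L v = sumOver (pathWeight v) (allLists E L)

  pathWeight-∷ : ∀ v e es →
    pathWeight v (e ∷ es) ≡ [ ⌊ src e ≟ v ⌋ ]? * (labelℕ (lab e) x * pathWeight (tgt e) es)
  pathWeight-∷ v e es with ⌊ src e ≟ v ⌋ | isPathFrom (tgt e) es
  ... | false | _     = refl
  ... | true  | true  = solve 2 (λ a b → con 1 :* (a :* b) := con 1 :* (a :* (con 1 :* b))) refl (labelℕ (lab e) x) (weight es)
    where open +-*-Solver
  ... | true  | false = solve 1 (λ a → con 0 := con 1 :* (a :* con 0)) refl (labelℕ (lab e) x)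
    where open +-*-Solver

  pathSum-suc : ∀ L v →
    pathSum (suc L) v ≡ sumOver (λ e → [ ⌊ src e ≟ v ⌋ ]? * (labelℕ (lab e) x * pathSum L (tgt e))) (allFin E)
  pathSum-suc L v =
    trans (sumOver-concatMap (pathWeight v) _ (allFin E)) (sumOver-cong (λ e → begin
      sumOver (pathWeight v) (map (e ∷_) (allLists E L))
        ≡⟨ sumOver-map (pathWeight v) (e ∷_) (allLists E L) ⟩
      sumOver (pathWeight v ∘ (e ∷_)) (allLists E L)
        ≡⟨ sumOver-cong (pathWeight-∷ v e) (allLists E L) ⟩
      sumOver (λ es → [ ⌊ src e ≟ v ⌋ ]? * (labelℕ (lab e) x * pathWeight (tgt e) es)) (allLists E L)
        ≡⟨ sumOver-* [ ⌊ src e ≟ v ⌋ ]? _ (allLists E L) ⟩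
      [ ⌊ src e ≟ v ⌋ ]? * sumOver (λ es → labelℕ (lab e) x * pathWeight (tgt e) es) (allLists E L)
        ≡⟨ cong ([ ⌊ src e ≟ v ⌋ ]? *_) (sumOver-* (labelℕ (lab e) x) _ (allLists E L)) ⟩
      [ ⌊ src e ≟ v ⌋ ]? * (labelℕ (lab e) x * pathSum L (tgt e)) ∎) (allFin E))

  total : ℕ → Fin (suc m) → ℕ
  total N v = sumOver (λ L → pathSum L v) (upTo N)

  total-suc : ∀ N v → total (suc N) v ≡ step v (total N)
  total-suc N v = begin
    pathSum 0 v + sumOver (λ L → pathSum L v) (applyUpTo suc N)
      ≡⟨ cong (pathSum 0 v +_) (cong (sumOver (λ L → pathSum L v)) (sym (map-upTo suc N))) ⟩
    pathSum 0 v + sumOver (λ L → pathSum L v) (map suc (upTo N))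
      ≡⟨ cong (pathSum 0 v +_) (sumOver-map (λ L → pathSum L v) suc (upTo N)) ⟩
    pathSum 0 v + sumOver (λ L → pathSum (suc L) v) (upTo N)
      ≡⟨ cong₂ _+_ (trans (+-identityʳ _) (*-identityʳ _)) (sumOver-cong (λ L → pathSum-suc L v) (upTo N)) ⟩
    [ ⌊ v ≟ sink ⌋ ]? + sumOver (λ L → sumOver (λ e → [ ⌊ src e ≟ v ⌋ ]? * (labelℕ (lab e) x * pathSum L (tgt e))) (allFin E)) (upTo N)
      ≡⟨ cong ([ ⌊ v ≟ sink ⌋ ]? +_) (sumOver-swap _ (upTo N) (allFin E)) ⟩
    [ ⌊ v ≟ sink ⌋ ]? + sumOver (λ e → sumOver (λ L → [ ⌊ src e ≟ v ⌋ ]? * (labelℕ (lab e) x * pathSum L (tgt e))) (upTo N)) (allFin E)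
      ≡⟨ cong ([ ⌊ v ≟ sink ⌋ ]? +_) (sumOver-cong (λ e →
           trans (sumOver-* [ ⌊ src e ≟ v ⌋ ]? _ (upTo N)) (cong ([ ⌊ src e ≟ v ⌋ ]? *_) (sumOver-* (labelℕ (lab e) x) _ (upTo N)))) (allFin E)) ⟩
    step v (total N) ∎

  -- A path from v has at most m ∸ toℕ v edges, so the sum over lengths below N stabilises there.
  total≡ : (W : Fin (suc m) → ℕ) → (∀ v → W v ≡ step v W) →
    ∀ N v → m < toℕ v + N → total N v ≡ W v
  total≡ W fix zero v m<v =
    contradiction (subst (m <_) (+-identityʳ _) m<v) (≤⇒≯ (toℕ≤pred[n] v))
  total≡ W fix (suc N) v m<v =
    trans (total-suc N v) (trans (cong ([ ⌊ v ≟ sink ⌋ ]? +_) (sumOver-cong edge (allFin E))) (sym (fix v)))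
    where
    edge : ∀ e → [ ⌊ src e ≟ v ⌋ ]? * (labelℕ (lab e) x * total N (tgt e))
               ≡ [ ⌊ src e ≟ v ⌋ ]? * (labelℕ (lab e) x * W (tgt e))
    edge e with src e ≟ v
    ... | no _     = refl
    -- By `acyclic` the target has a larger number than v, which makes up for the decrease of N.
    ... | yes refl = cong (λ t → 1 * (labelℕ (lab e) x * t)) (total≡ W fix N (tgt e)
                       (<-≤-trans (subst (m <_) (+-suc (toℕ (src e)) N) m<v) (+-monoˡ-≤ N (acyclic e))))

  -- Replaces the enumeration of paths by a local check at each vertex. The lengths 0 to m are
  -- covered because a path visits each of the `suc m` vertices at most once.
  evalABP-fixpoint : (W : Fin (suc m) → ℕ) → (∀ v → W v ≡ step v W) → evalABP P x ≡ W zero mod p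
  evalABP-fixpoint W fix = trans evalABP≡sum (cong (_mod p)
    (trans (sumOver-concatMap (pathWeight source) (allLists E) (upTo (suc m)))
           (total≡ W fix (suc m) zero ≤-refl)))

-- Straight-line programs as branching programs

-- Vertices are numbered from the newest (zero) down to the sink; a new vertex has two edges.
data Prog (p w : ℕ) : ℕ → Set where
  one : Prog p w 0
  ext : ∀ {m} → Prog p w m → (ℓ ℓ′ : Label p w) (v v′ : Fin (suc m)) → Prog p w (suc m)

val : ∀ {p w m} → Prog p w m → (Fin w → Bool) → Fin (suc m) → ℕ
val one               x v       = 1
val (ext P ℓ ℓ′ v v′) x zero    = labelℕ ℓ x * val P x v + labelℕ ℓ′ x * val P x v′
val (ext P ℓ ℓ′ v v′) x (suc u) = val P x u

val-sink : ∀ {p w m} (P : Prog p w m) x → val P x (fromℕ m) ≡ 1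
val-sink one               x = refl
val-sink (ext P ℓ ℓ′ v v′) x = val-sink P x

module ToABP {p w : ℕ} .{{_ : NonZero p}} where
  open GF p
  open ≡-Reasoning

  Edge : ℕ → Set
  Edge m = Fin (suc m) × Fin (suc m) × Label p w

  shift : ∀ {m} → Edge m → Edge (suc m)
  shift (s , t , ℓ) = suc s , suc t , ℓ

  out : ∀ {m} → Label p w → Fin (suc m) → Edge (suc m)
  out ℓ v = zero , suc v , ℓ

  -- The edges labelled 0 contribute nothing; they make zero the only source and the sink the only sink.
  edges : ∀ {m} → Prog p w m → List (Edge m)
  edges one = []
  edges {suc m} (ext P ℓ ℓ′ v v′) =
    out ℓ v ∷ out ℓ′ v′ ∷ map (out (cst 0ₚ)) (allFin (suc m)) ++ map shift (edges P)

  -- A new vertex above `suc m` old ones brings two proper edges and `suc m` edges labelled 0, so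
  -- the growth is quadratic.
  length-edges : ∀ {m} (P : Prog p w m) → length (edges P) ≤ m * (m + 2)
  length-edges one = z≤n
  length-edges {suc m} (ext P ℓ ℓ′ v v′) = ≤-trans (≤-reflexive count) (≤-trans
    (+-monoʳ-≤ 2 (+-monoʳ-≤ (suc m) (length-edges P))) (≤-trans (m≤m+n _ m) (≤-reflexive
    (solve 1 (λ m → con 2 :+ (con 1 :+ m :+ m :* (m :+ con 2)) :+ m := (con 1 :+ m) :* (con 1 :+ m :+ con 2)) refl m))))
    where
    open +-*-Solver
    zs = map (out (cst 0ₚ)) (allFin (suc m))
    count : 2 + length (zs ++ map shift (edges P)) ≡ 2 + (suc m + length (edges P))
    count = cong (2 +_) (trans (length-++ zs) (cong₂ _+_
      (trans (length-map (out (cst 0ₚ)) (allFin (suc m))) (length-tabulate {n = suc m} id))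
      (length-map shift (edges P))))

  edges-acyclic : ∀ {m} (P : Prog p w m) → All (λ (s , t , _) → toℕ s < toℕ t) (edges P)
  edges-acyclic one = []
  edges-acyclic {suc m} (ext P ℓ ℓ′ v v′) =
    s≤s z≤n ∷ s≤s z≤n ∷ All.++⁺ (All.map⁺ (All.universal (λ _ → s≤s z≤n) (allFin (suc m))))
                                 (All.map⁺ (All.map s≤s (edges-acyclic P)))

  zero-edge : ∀ {m} (P : Prog p w m) {ℓ ℓ′ v v′} u → out (cst 0ₚ) u ∈ˡ edges (ext P ℓ ℓ′ v v′)
  zero-edge P u = there (there (∈-++⁺ˡ (∈-map⁺ (out (cst 0ₚ)) (∈-allFin u))))

  edges-in : ∀ {m} (P : Prog p w m) v → v ≢ zero → ∃ λ e → e ∈ˡ edges P × proj₁ (proj₂ e) ≡ v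
  edges-in P                   zero    v≢0 = contradiction refl v≢0
  edges-in (ext P ℓ ℓ′ v v′) (suc u) _   = _ , zero-edge P u , refl

  edges-out : ∀ {m} (P : Prog p w m) v → v ≢ fromℕ m → ∃ λ e → e ∈ˡ edges P × proj₁ e ≡ v
  edges-out one               zero    v≢ = contradiction refl v≢
  edges-out (ext P ℓ ℓ′ v v′) zero    _  = _ , zero-edge P zero , refl
  edges-out {suc m} (ext P ℓ ℓ′ v v′) (suc u) u≢ with edges-out P u (u≢ ∘ cong suc)
  ... | e , e∈ , eq = shift e , there (there (∈-++⁺ʳ (map (out (cst 0ₚ)) (allFin (suc m))) (∈-map⁺ shift e∈))) , cong suc eq

  toABP : ∀ {m} → Prog p w m → ABP p w
  toABP {m} P = record
    { m = m
    ; E = length (edges P)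
    ; src = λ e → proj₁ (List.lookup (edges P) e)
    ; tgt = λ e → proj₁ (proj₂ (List.lookup (edges P) e))
    ; lab = λ e → proj₂ (proj₂ (List.lookup (edges P) e))
    ; acyclic = λ e → All.lookup (edges-acyclic P) (∈-lookup e)
    ; oneSource = λ v v≢ → let (e , e∈ , eq) = edges-in P v v≢ in
        index e∈ , trans (cong (λ e → proj₁ (proj₂ e)) (sym (lookup-index e∈))) eq
    ; oneSink = λ v v≢ → let (e , e∈ , eq) = edges-out P v v≢ in
        index e∈ , trans (cong proj₁ (sym (lookup-index e∈))) eq
    }

  module _ (x : Fin w → Bool) where

    flow : ∀ {m} → (Fin (suc m) → ℕ) → Fin (suc m) → Edge m → ℕ
    flow W v (s , t , ℓ) = [ ⌊ s ≟ v ⌋ ]? * (labelℕ ℓ x * W t)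

    flow-suc : ∀ {m} (W : Fin (suc (suc m)) → ℕ) u e → flow W (suc u) (shift e) ≡ flow (W ∘ suc) u e
    flow-suc W u (s , t , ℓ) = cong (λ b → [ b ]? * (labelℕ ℓ x * W (suc t))) (≟-suc s u)

    -- The fixed-point equation required by `evalABP-fixpoint`, with the edges taken from a list
    -- instead of by index.
    val-step : ∀ {m} (P : Prog p w m) v →
      val P x v ≡ [ ⌊ v ≟ fromℕ m ⌋ ]? + sumOver (flow (val P x) v) (edges P)
    val-step one zero = refl
    val-step {suc m} P′@(ext P ℓ ℓ′ v v′) zero = begin
      labelℕ ℓ x * val P x v + labelℕ ℓ′ x * val P x v′
        ≡⟨ solve 2 (λ a b → a :+ b := con 1 :* a :+ (con 1 :* b :+ con 0)) refl (labelℕ ℓ x * val P x v) (labelℕ ℓ′ x * val P x v′) ⟩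
      1 * (labelℕ ℓ x * val P x v) + (1 * (labelℕ ℓ′ x * val P x v′) + 0)
        ≡⟨ cong (λ t → 1 * (labelℕ ℓ x * val P x v) + (1 * (labelℕ ℓ′ x * val P x v′) + t)) rest ⟨
      sumOver (flow (val P′ x) zero) (edges P′) ∎
      where
      open +-*-Solver
      zs = map (out (cst 0ₚ)) (allFin (suc m))
      rest : sumOver (flow (val P′ x) zero) (zs ++ map shift (edges P)) ≡ 0
      -- The padding edges at the new vertex carry the label 0, and the shifted edges start at other
      -- vertices.
      rest = trans (sumOver-++ (flow (val P′ x) zero) zs (map shift (edges P))) (cong₂ _+_
        (trans (sumOver-map (flow (val P′ x) zero) (out (cst 0ₚ)) (allFin (suc m))) (trans (sumOver-cong (λ u →
          cong (λ t → 1 * (t * val P x u)) (trans (ModArith.toℕ-mod p 0) (m<n⇒m%n≡m (>-nonZero⁻¹ p)))) (allFin (suc m))) (sumOver-0 (allFin (suc m)))))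
        (trans (sumOver-map (flow (val P′ x) zero) shift (edges P)) (sumOver-0 (edges P))))
    val-step {suc m} P′@(ext P ℓ ℓ′ v v′) (suc u) =
      trans (val-step P u) (cong₂ (λ b t → [ b ]? + t) (sym (≟-suc u (fromℕ m))) (sym rest))
      where
      zs = map (out (cst 0ₚ)) (allFin (suc m))
      rest : sumOver (flow (val P′ x) (suc u)) (zs ++ map shift (edges P)) ≡ sumOver (flow (val P x) u) (edges P)
      rest = trans (sumOver-++ (flow (val P′ x) (suc u)) zs (map shift (edges P))) (cong₂ _+_
        (trans (sumOver-map (flow (val P′ x) (suc u)) (out (cst 0ₚ)) (allFin (suc m))) (sumOver-0 (allFin (suc m))))
        (trans (sumOver-map (flow (val P′ x) (suc u)) shift (edges P)) (sumOver-cong (flow-suc (val P′ x) u) (edges P))))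

    evalABP-toABP : ∀ {m} (P : Prog p w m) → evalABP (toABP P) x ≡ val P x zero mod p
    evalABP-toABP P = PathSum.evalABP-fixpoint (toABP P) x (val P x) λ v →
      trans (val-step P v) (cong ([ ⌊ v ≟ _ ⌋ ]? +_) (sym (sumOver-lookup (flow (val P x) v) (edges P))))

-- Sums over finite index sets

sumFin-cong : ∀ {w} {f g : Fin w → ℕ} → f ≗ g → sumFin w f ≡ sumFin w g
sumFin-cong {zero}  eq = refl
sumFin-cong {suc w} eq = cong₂ _+_ (eq zero) (sumFin-cong (eq ∘ suc))

sumFin-≤ : ∀ {w b} (f : Fin w → ℕ) → (∀ i → f i ≤ b) → sumFin w f ≤ w * b
sumFin-≤ {zero}  f bound = ≤-refl
sumFin-≤ {suc w} f bound = +-mono-≤ (bound zero) (sumFin-≤ (f ∘ suc) (bound ∘ suc))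

summand-≤ : ∀ {w} (f : Fin w → ℕ) i → f i ≤ sumFin w f
summand-≤ f zero    = m≤m+n (f zero) _
summand-≤ f (suc i) = ≤-trans (summand-≤ (f ∘ suc) i) (m≤n+m _ (f zero))

sumFin-0 : ∀ w → sumFin w (λ _ → 0) ≡ 0
sumFin-0 zero    = refl
sumFin-0 (suc w) = sumFin-0 w

sumFin-select : ∀ {k} (h : Fin k) (f : Fin k → ℕ) → sumFin k (λ j → [ ⌊ h ≟ j ⌋ ]? * f j) ≡ f h
sumFin-select {suc k} zero    f = begin
  1 * f zero + sumFin k (λ j → 0)  ≡⟨ cong₂ _+_ (*-identityˡ (f zero)) (sumFin-0 k) ⟩
  f zero + 0                       ≡⟨ +-identityʳ (f zero) ⟩
  f zero                           ∎
  where open ≡-Reasoning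
sumFin-select {suc k} (suc h) f = trans
  (sumFin-cong (λ j → cong (λ b → [ b ]? * f (suc j)) (≟-suc h j)))
  (sumFin-select h (f ∘ suc))

-- Expressions compiled into gates

infixr 7 _·_
infixl 6 _⊞_

-- Every monomial is a product of bits with at most one vertex value. Such expressions are what new
-- vertices with edges into an existing program can compute; a product of two vertices is
-- deliberately absent.
data Expr (B V : Set) : Set where
  nought unit : Expr B V
  vtx         : V → Expr B V
  _·_         : B → Expr B V → Expr B V
  _⊞_         : Expr B V → Expr B V → Expr B V

module _ {B V : Set} where

  ⟦_⟧ : Expr B V → (B → Bool) → (V → ℕ) → ℕ
  ⟦ nought ⟧ β ν = 0
  ⟦ unit   ⟧ β ν = 1
  ⟦ vtx v  ⟧ β ν = ν v
  ⟦ b · E  ⟧ β ν = [ β b ]? * ⟦ E ⟧ β ν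
  ⟦ E ⊞ F  ⟧ β ν = ⟦ E ⟧ β ν + ⟦ F ⟧ β ν

  ⟦⟧-cong : ∀ E {β : B → Bool} {ν ν′ : V → ℕ} → ν ≗ ν′ → ⟦ E ⟧ β ν ≡ ⟦ E ⟧ β ν′
  ⟦⟧-cong nought  eq = refl
  ⟦⟧-cong unit    eq = refl
  ⟦⟧-cong (vtx v) eq = eq v
  ⟦⟧-cong (b · E) {β} eq = cong ([ β b ]? *_) (⟦⟧-cong E eq)
  ⟦⟧-cong (E ⊞ F) eq = cong₂ _+_ (⟦⟧-cong E eq) (⟦⟧-cong F eq)

  -- The number of vertices that compilation adds. `unit` is free because the sink has value 1,
  -- whereas a vertex of value 0 has to be made.
  size : Expr B V → ℕ
  size nought  = 1
  size unit    = 0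
  size (vtx v) = 0
  size (b · E) = suc (size E)
  size (E ⊞ F) = suc (size F + size E)

  bit : Bool → Expr B V
  bit true  = unit
  bit false = nought

  ⟦bit⟧ : ∀ b {β ν} → ⟦ bit b ⟧ β ν ≡ [ b ]?
  ⟦bit⟧ true  = refl
  ⟦bit⟧ false = refl

  sumE : ∀ {k} → (Fin k → Expr B V) → Expr B V
  sumE {zero}  E = nought
  sumE {suc k} E = E zero ⊞ sumE (E ∘ suc)

  ⟦sumE⟧ : ∀ {k} (E : Fin k → Expr B V) {β ν} → ⟦ sumE E ⟧ β ν ≡ sumFin k (λ i → ⟦ E i ⟧ β ν)
  ⟦sumE⟧ {zero}  E = refl
  ⟦sumE⟧ {suc k} E = cong (⟦ E zero ⟧ _ _ +_) (⟦sumE⟧ (E ∘ suc))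

  mux : ∀ {k} → (Fin k → B) → (Fin k → Expr B V) → Expr B V
  mux b E = sumE (λ j → b j · E j)

  ⟦mux⟧ : ∀ {k} (b : Fin k → B) (E : Fin k → Expr B V) {β ν} h →
    (∀ j → β (b j) ≡ ⌊ h ≟ j ⌋) → ⟦ mux b E ⟧ β ν ≡ ⟦ E h ⟧ β ν
  ⟦mux⟧ b E {β} {ν} h sel = begin
    ⟦ mux b E ⟧ β ν                                  ≡⟨ ⟦sumE⟧ (λ j → b j · E j) ⟩
    sumFin _ (λ j → [ β (b j) ]? * ⟦ E j ⟧ β ν)       ≡⟨ sumFin-cong (λ j → cong (λ t → [ t ]? * ⟦ E j ⟧ β ν) (sel j)) ⟩
    sumFin _ (λ j → [ ⌊ h ≟ j ⌋ ]? * ⟦ E j ⟧ β ν)     ≡⟨ sumFin-select h (λ j → ⟦ E j ⟧ β ν) ⟩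
    ⟦ E h ⟧ β ν                                      ∎
    where open ≡-Reasoning

  -- A decision tree that reads off a function h : Fin r → Fin k from the indicators of h i = j.
  muxes : ∀ {r k} → (Fin r → Fin k → B) → ((Fin r → Fin k) → Expr B V) → Expr B V
  muxes {zero}  b E = E λ ()
  muxes {suc r} b E = mux (b zero) (λ j → muxes (b ∘ suc) (λ h → E (j Vector.∷ h)))

-- muxes hands its body a function built argument by argument, only pointwise equal to h.
rebuild : ∀ {r} {X : Set} → (Fin r → X) → Fin r → X
rebuild {zero}  h = λ ()
rebuild {suc r} h = h zero Vector.∷ rebuild (h ∘ suc)

rebuild-≗ : ∀ {r} {X : Set} (h : Fin r → X) → rebuild h ≗ h
rebuild-≗ h zero    = refl
rebuild-≗ h (suc i) = rebuild-≗ (h ∘ suc) i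

⟦muxes⟧ : ∀ {B V : Set} {r k} (b : Fin r → Fin k → B) (E : (Fin r → Fin k) → Expr B V) {β ν} h →
  (∀ i j → β (b i j) ≡ ⌊ h i ≟ j ⌋) → ⟦ muxes b E ⟧ β ν ≡ ⟦ E (rebuild h) ⟧ β ν
⟦muxes⟧ {r = zero}  b E h sel = refl
⟦muxes⟧ {r = suc r} b E h sel =
  trans (⟦mux⟧ (b zero) _ (h zero) (sel zero))
        (⟦muxes⟧ (b ∘ suc) (λ h′ → E (h zero Vector.∷ h′)) (h ∘ suc) (sel ∘ suc))

-- Numbering from the newest vertex shifts all numbers at each addition, so an extension must carry
-- the embedding `old` of the earlier vertices.
record Extension {p w m} (P : Prog p w m) (J : Set) : Set where
  field
    {m′}    : ℕ
    prog    : Prog p w m′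
    old     : Fin (suc m) → Fin (suc m′)
    old-val : ∀ x u → val prog x (old u) ≡ val P x u
    new     : J → Fin (suc m′)

-- The w wires, then the vertices and the edge bound of `length-edges` for a program with M vertices
-- beyond the sink and one more for the output.
gateBound : ℕ → ℕ → ℕ
gateBound w M = w + (suc (suc M) + suc M * (suc M + 2))

gateBound-mono : ∀ w {M M′} → M ≤ M′ → gateBound w M ≤ gateBound w M′
gateBound-mono w M≤M′ =
  +-monoʳ-≤ w (+-mono-≤ (+-monoʳ-≤ 2 M≤M′) (*-mono-≤ (+-monoʳ-≤ 1 M≤M′) (+-monoˡ-≤ 2 (+-monoʳ-≤ 1 M≤M′))))

isOne : ∀ {p} {{_ : NonZero p}} → Fin p → Bool
isOne {p} v = ⌊ v ≟ 1 mod p ⌋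

isOne-bit : ∀ {p} {{_ : NonZero p}} → 1 < p → ∀ b → isOne {p} ([ b ]? mod p) ≡ b
isOne-bit {p} 1<p true with (1 mod p) ≟ (1 mod p)
... | yes _  = refl
... | no  ≢  = contradiction refl ≢
isOne-bit {p} 1<p false with (0 mod p) ≟ (1 mod p)
... | no  _  = refl
... | yes eq = contradiction (begin
  0              ≡⟨ m<n⇒m%n≡m (<-trans (n<1+n 0) 1<p) ⟨
  0 % p          ≡⟨ toℕ-mod 0 ⟨
  toℕ (0 mod p)  ≡⟨ cong toℕ eq ⟩
  toℕ (1 mod p)  ≡⟨ toℕ-mod 1 ⟩
  1 % p          ≡⟨ m<n⇒m%n≡m 1<p ⟩
  1              ∎) 0≢1+n
  where
  open ModArith p
  open ≡-Reasoning

module Compile {p : ℕ} {{p≢0 : NonZero p}} (1<p : 1 < p) {w : ℕ} {B : Set} (enc : B → Fin w) where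
  open GF p
  open ModArith p
  open Extension
  open ≡-Reasoning

  label-1 : ∀ x → labelℕ {p} {w} (cst 1ₚ) x ≡ 1
  label-1 x = trans (toℕ-mod 1) (m<n⇒m%n≡m 1<p)

  label-0 : ∀ x → labelℕ {p} {w} (cst 0ₚ) x ≡ 0
  label-0 x = trans (toℕ-mod 0) (m<n⇒m%n≡m (<-trans (n<1+n 0) 1<p))

  module _ {V : Set} where

    compile : ∀ {m} (P : Prog p w m) → (V → Fin (suc m)) → Expr B V → Extension P ⊤
    compile P φ nought  = record
      { prog = ext P (cst 0ₚ) (cst 0ₚ) zero zero ; old = suc ; old-val = λ _ _ → refl ; new = λ _ → zero }
    compile {m} P φ unit = record { prog = P ; old = λ u → u ; old-val = λ _ _ → refl ; new = λ _ → fromℕ m }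
    compile P φ (vtx v) = record { prog = P ; old = λ u → u ; old-val = λ _ _ → refl ; new = λ _ → φ v }
    compile P φ (b · E) = let X = compile P φ E in record
      { prog = ext (prog X) (var (enc b)) (cst 0ₚ) (new X tt) zero
      ; old = suc ∘ old X ; old-val = old-val X ; new = λ _ → zero }
    compile P φ (E ⊞ F) =
      let X = compile P φ E
          Y = compile (prog X) (old X ∘ φ) F in record
      { prog = ext (prog Y) (cst 1ₚ) (cst 1ₚ) (old Y (new X tt)) (new Y tt)
      ; old = suc ∘ old Y ∘ old X
      ; old-val = λ x u → trans (old-val Y x (old X u)) (old-val X x u)
      ; new = λ _ → zero }

    compile-size : ∀ {m} (P : Prog p w m) φ E → m′ (compile P φ E) ≡ size E + m
    compile-size P φ nought  = refl
    compile-size P φ unit    = refl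
    compile-size P φ (vtx v) = refl
    compile-size P φ (b · E) = cong suc (compile-size P φ E)
    compile-size {m} P φ (E ⊞ F) = let X = compile P φ E in cong suc (begin
      m′ (compile (prog X) (old X ∘ φ) F)  ≡⟨ compile-size (prog X) (old X ∘ φ) F ⟩
      size F + m′ X                        ≡⟨ cong (size F +_) (compile-size P φ E) ⟩
      size F + (size E + m)                ≡⟨ +-assoc (size F) (size E) m ⟨
      size F + size E + m                  ∎)

    compile-val : ∀ {m} (P : Prog p w m) φ E x →
      val (prog (compile P φ E)) x (new (compile P φ E) tt) ≡ ⟦ E ⟧ (x ∘ enc) (val P x ∘ φ)
    compile-val P φ nought  x = cong₂ (λ a b → a * val P x zero + b * val P x zero) (label-0 x) (label-0 x)
    compile-val P φ unit    x = val-sink P x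
    compile-val P φ (vtx v) x = refl
    compile-val P φ (b · E) x = let X = compile P φ E in begin
      [ x (enc b) ]? * val (prog X) x (new X tt) + labelℕ (cst 0ₚ) x * val (prog X) x zero
        ≡⟨ cong₂ (λ a c → [ x (enc b) ]? * a + c * val (prog X) x zero) (compile-val P φ E x) (label-0 x) ⟩
      [ x (enc b) ]? * ⟦ E ⟧ (x ∘ enc) (val P x ∘ φ) + 0
        ≡⟨ +-identityʳ _ ⟩
      [ x (enc b) ]? * ⟦ E ⟧ (x ∘ enc) (val P x ∘ φ) ∎
    compile-val P φ (E ⊞ F) x = let X = compile P φ E; Y = compile (prog X) (old X ∘ φ) F in cong₂ _+_
      (trans (cong₂ _*_ (label-1 x) (trans (old-val Y x (new X tt)) (compile-val P φ E x))) (*-identityˡ _))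
      (trans (cong₂ _*_ (label-1 x) (trans (compile-val (prog X) (old X ∘ φ) F x)
               (⟦⟧-cong F (λ v → old-val X x (φ v))))) (*-identityˡ _))

    compileAll : ∀ {m} (P : Prog p w m) → (V → Fin (suc m)) → ∀ {k} → (Fin k → Expr B V) → Extension P (Fin k)
    compileAll P φ {zero}  E = record { prog = P ; old = λ u → u ; old-val = λ _ _ → refl ; new = λ () }
    compileAll P φ {suc k} E =
      let X = compile P φ (E zero)
          Y = compileAll (prog X) (old X ∘ φ) (E ∘ suc) in record
      { prog = prog Y ; old = old Y ∘ old X
      ; old-val = λ x u → trans (old-val Y x (old X u)) (old-val X x u)
      ; new = old Y (new X tt) Vector.∷ new Y }

    compileAll-size : ∀ {m} (P : Prog p w m) φ {k} (E : Fin k → Expr B V) →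
      m′ (compileAll P φ E) ≡ sumFin k (size ∘ E) + m
    compileAll-size P φ {zero}  E = refl
    compileAll-size {m} P φ {suc k} E = let X = compile P φ (E zero) in begin
      m′ (compileAll (prog X) (old X ∘ φ) (E ∘ suc))    ≡⟨ compileAll-size (prog X) (old X ∘ φ) (E ∘ suc) ⟩
      sumFin k (size ∘ E ∘ suc) + m′ X                  ≡⟨ cong (sumFin k (size ∘ E ∘ suc) +_) (compile-size P φ (E zero)) ⟩
      sumFin k (size ∘ E ∘ suc) + (size (E zero) + m)   ≡⟨ solve 3 (λ a b c → a :+ (b :+ c) := b :+ a :+ c) refl (sumFin k (size ∘ E ∘ suc)) (size (E zero)) m ⟩
      size (E zero) + sumFin k (size ∘ E ∘ suc) + m     ∎
      where open +-*-Solver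

    compileAll-val : ∀ {m} (P : Prog p w m) φ {k} (E : Fin k → Expr B V) x i →
      val (prog (compileAll P φ E)) x (new (compileAll P φ E) i) ≡ ⟦ E i ⟧ (x ∘ enc) (val P x ∘ φ)
    compileAll-val P φ E x zero = let X = compile P φ (E zero) in
      trans (old-val (compileAll (prog X) (old X ∘ φ) (E ∘ suc)) x (new X tt)) (compile-val P φ (E zero) x)
    compileAll-val P φ E x (suc i) = let X = compile P φ (E zero) in
      trans (compileAll-val (prog X) (old X ∘ φ) (E ∘ suc) x i) (⟦⟧-cong (E (suc i)) (λ v → old-val X x (φ v)))

    module _ {m : ℕ} (P : Prog p w m) (φ : V → Fin (suc m)) (E : Expr B V) where

      -- The output has to be the newest vertex, the source of the branching program.
      output : Prog p w (suc (m′ (compile P φ E)))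
      output = let X = compile P φ E in ext (prog X) (cst 1ₚ) (cst 0ₚ) (new X tt) zero

      -- Abstract, because comparing unfolded branching programs is too slow.
      abstract
        mkGate : (Fin p → Bool) → Gate p w
        mkGate accepts = record { nz = p≢0 ; r = w ; wire = λ j → j ; abp = ToABP.toABP output ; acc = accepts }

        gateOut-mkGate : ∀ accepts x → gateOut (mkGate accepts) x ≡ accepts (⟦ E ⟧ (x ∘ enc) (val P x ∘ φ) mod p)
        gateOut-mkGate accepts x = cong accepts (trans (ToABP.evalABP-toABP x output) (cong (_mod p) (begin
          labelℕ (cst 1ₚ) x * val (prog X) x (new X tt) + labelℕ (cst 0ₚ) x * val (prog X) x zero
            ≡⟨ cong₂ (λ a b → a * val (prog X) x (new X tt) + b * val (prog X) x zero) (label-1 x) (label-0 x) ⟩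
          1 * val (prog X) x (new X tt) + 0
            ≡⟨ trans (+-identityʳ _) (*-identityˡ _) ⟩
          val (prog X) x (new X tt)
            ≡⟨ compile-val P φ E x ⟩
          ⟦ E ⟧ (x ∘ enc) (val P x ∘ φ) ∎)))
          where
          X : Extension P ⊤
          X = compile P φ E

        gateSize-mkGate : ∀ accepts → gateSize (mkGate accepts) ≤ gateBound w (size E + m)
        gateSize-mkGate accepts rewrite sym (compile-size P φ E) =
          +-monoʳ-≤ w (+-monoʳ-≤ (suc (suc (m′ (compile P φ E)))) (ToABP.length-edges output))

-- Abelian groups without a distinguished zero

-- `D x y z` plays the role of x - y + z. Operations move blocks to blocks without respecting chosen
-- elements, so the zero has to remain a free choice.
record AbelianHeap : Set₁ where
  infix 4 _≈_
  field
    Carrier       : Set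
    _≈_           : Carrier → Carrier → Set
    isEquivalence : IsEquivalence _≈_
    D             : Carrier → Carrier → Carrier → Carrier
    D-cong        : ∀ {x x′ y y′ z z′} → x ≈ x′ → y ≈ y′ → z ≈ z′ → D x y z ≈ D x′ y′ z′
    D-xyy         : ∀ x y → D x y y ≈ x
    D-yyx         : ∀ x y → D y y x ≈ x
    D-medial      : ∀ x₁ x₂ x₃ y₁ y₂ y₃ z₁ z₂ z₃ →
      D (D x₁ x₂ x₃) (D y₁ y₂ y₃) (D z₁ z₂ z₃) ≈ D (D x₁ y₁ z₁) (D x₂ y₂ z₂) (D x₃ y₃ z₃)

  setoid : Setoid 0ℓ 0ℓ
  setoid = record { isEquivalence = isEquivalence }

  open IsEquivalence isEquivalence public using () renaming (refl to ≈-refl; sym to ≈-sym; trans to ≈-trans; reflexive to ≈-reflexive)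

  monoid : Carrier → CommutativeMonoid 0ℓ 0ℓ
  monoid e = record
    { Carrier = Carrier
    ; _≈_ = _≈_
    ; _∙_ = λ x y → D x e y
    ; ε = e
    ; isCommutativeMonoid = record
      { isMonoid = record
        { isSemigroup = record
          { isMagma = record
            { isEquivalence = isEquivalence
            ; ∙-cong = λ x≈x′ y≈y′ → D-cong x≈x′ ≈-refl y≈y′
            }
          -- An Eckmann-Hilton argument, here and for `comm`: pad with e to a 3 × 3 array and
          -- transpose it by `D-medial`.
          ; assoc = λ x y z → begin
              D (D x e y) e z                      ≈⟨ D-cong ≈-refl (≈-sym (D-xyy e e)) (≈-sym (D-yyx z e)) ⟩
              D (D x e y) (D e e e) (D e e z)      ≈⟨ D-medial x e y e e e e e z ⟩
              D (D x e e) (D e e e) (D y e z)      ≈⟨ D-cong (D-xyy x e) (D-xyy e e) ≈-refl ⟩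
              D x e (D y e z)                      ∎
          }
        ; identity = (λ x → D-yyx x e) , (λ x → D-xyy x e)
        }
      ; comm = λ x y → begin
          D x e y                              ≈⟨ D-cong (≈-sym (D-yyx x e)) (≈-sym (D-xyy e e)) (≈-sym (D-xyy y e)) ⟩
          D (D e e x) (D e e e) (D y e e)      ≈⟨ D-medial e e x e e e y e e ⟩
          D (D e e y) (D e e e) (D x e e)      ≈⟨ D-cong (D-yyx y e) (D-xyy e e) (D-xyy x e) ⟩
          D y e x                              ∎
      }
    }
    where open import Relation.Binary.Reasoning.Setoid setoid

  -- Subtracts x from both sides: the array has the rows e - x + x, e - e + e and e - e + y, and its
  -- last column is the hypothesis. Finite orders come from this.
  cancel : ∀ {e} x y → D x e y ≈ x → y ≈ e
  cancel {e} x y xy≈x = begin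
    y                                ≈⟨ D-yyx y e ⟨
    D e e y                          ≈⟨ D-cong (D-xyy e x) (D-yyx e e) (D-yyx y e) ⟨
    D (D e x x) (D e e e) (D e e y)  ≈⟨ D-medial e x x e e e e e y ⟩
    D (D e e e) (D x e e) (D x e y)  ≈⟨ D-cong (D-yyx e e) (D-xyy x e) xy≈x ⟩
    D e x x                          ≈⟨ D-xyy e x ⟩
    e                                ∎
    where open import Relation.Binary.Reasoning.Setoid setoid


module InHeap (H : AbelianHeap) (e : AbelianHeap.Carrier H) where
  open CommutativeMonoid (AbelianHeap.monoid H e) public using (_∙_; ε; ∙-cong; ∙-congˡ; assoc; identityˡ; identityʳ; comm)
  open AbelianHeap H public hiding (monoid)
  open Algebra.Properties.CommutativeMonoid.Sum (AbelianHeap.monoid H e) public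
  open Algebra.Properties.CommutativeMonoid.Mult (AbelianHeap.monoid H e) public renaming (_×_ to infixr 8 _⋆_)
  open import Relation.Binary.Reasoning.Setoid setoid

  sum-zero : ∀ {n} (t : Fin n → Carrier) → (∀ j → t j ≈ ε) → sum t ≈ ε
  sum-zero {n} t zeros = ≈-trans (sum-cong-≋ zeros) (sum-replicate-zero n)

  sum-single : ∀ {n} (t : Fin n → Carrier) i → (∀ j → i ≢ j → t j ≈ ε) → sum t ≈ t i
  sum-single t zero    others = begin
    t zero ∙ sum (t ∘ suc)  ≈⟨ ∙-congˡ (sum-zero (t ∘ suc) (λ j → others (suc j) λ ())) ⟩
    t zero ∙ ε              ≈⟨ identityʳ _ ⟩
    t zero                  ∎
  sum-single t (suc i) others = begin
    t zero ∙ sum (t ∘ suc)  ≈⟨ ∙-cong (others zero λ ()) (sum-single (t ∘ suc) i (λ j i≢j → others (suc j) λ { refl → i≢j refl })) ⟩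
    ε ∙ t (suc i)           ≈⟨ identityˡ _ ⟩
    t (suc i)               ∎

  ⋆-zero : ∀ n → n ⋆ ε ≈ ε
  ⋆-zero n = ≈-trans (≈-sym (sum-replicate n)) (sum-replicate-zero n)

-- Affine maps and linear combinations

record Hom (H K : AbelianHeap) : Set where
  private
    module H = AbelianHeap H
    module K = AbelianHeap K
  field
    fun      : H.Carrier → K.Carrier
    fun-cong : ∀ {x y} → x H.≈ y → fun x K.≈ fun y
    fun-D    : ∀ x y z → fun (H.D x y z) K.≈ K.D (fun x) (fun y) (fun z)

module Linearise {H K : AbelianHeap} (h : Hom H K) (e : AbelianHeap.Carrier H) (e′ : AbelianHeap.Carrier K) where
  open Hom h
  private
    module H = InHeap H e
    module K = InHeap K e′
  open import Relation.Binary.Reasoning.Setoid K.setoid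

  -- The affine map without its constant term, `fun x` - `fun e` + e′; it is a homomorphism for the
  -- zeros e and e′.
  linear : H.Carrier → K.Carrier
  linear x = K.D (fun x) (fun e) e′

  linear-cong : ∀ {x y} → x H.≈ y → linear x K.≈ linear y
  linear-cong x≈y = K.D-cong (fun-cong x≈y) K.≈-refl K.≈-refl

  linear-ε : linear e K.≈ e′
  linear-ε = K.D-yyx e′ (fun e)

  linear-∙ : ∀ x y → linear (x H.∙ y) K.≈ linear x K.∙ linear y
  linear-∙ x y = begin
    K.D (fun (H.D x e y)) a e′
      ≈⟨ K.D-cong (fun-D x e y) (K.≈-sym (K.D-xyy a a)) (K.≈-sym (K.D-xyy e′ e′)) ⟩
    K.D (K.D (fun x) a (fun y)) (K.D a a a) (K.D e′ e′ e′)
      ≈⟨ K.D-medial (fun x) a (fun y) a a a e′ e′ e′ ⟩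
    K.D (linear x) (K.D a a e′) (linear y)
      ≈⟨ K.D-cong K.≈-refl (K.D-yyx e′ a) K.≈-refl ⟩
    K.D (linear x) e′ (linear y) ∎
    where a = fun e

  linear-sum : ∀ {n} (t : Fin n → H.Carrier) → linear (H.sum t) K.≈ K.sum (linear ∘ t)
  linear-sum {zero}  t = linear-ε
  linear-sum {suc n} t = K.≈-trans (linear-∙ (t zero) (H.sum (t ∘ suc))) (K.∙-congˡ (linear-sum (t ∘ suc)))

  linear-⋆ : ∀ n x → linear (n H.⋆ x) K.≈ n K.⋆ linear x
  linear-⋆ zero    x = linear-ε
  linear-⋆ (suc n) x = K.≈-trans (linear-∙ x (n H.⋆ x)) (K.∙-congˡ (linear-⋆ n x))

  fun≈linear : ∀ x → fun x K.≈ linear x K.∙ fun e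
  fun≈linear x = begin
    fun x
      ≈⟨ K.≈-trans (K.D-cong (K.D-xyy (fun x) a) (K.D-xyy a a) (K.D-yyx a e′)) (K.D-xyy (fun x) a) ⟨
    K.D (K.D (fun x) a a) (K.D a a a) (K.D e′ e′ a)
      ≈⟨ K.D-medial (fun x) a a a a a e′ e′ a ⟩
    K.D (linear x) (K.D a a e′) (K.D a a a)
      ≈⟨ K.D-cong K.≈-refl (K.D-yyx e′ a) (K.D-xyy a a) ⟩
    K.D (linear x) e′ a ∎
    where a = fun e

-- Makes a basic operation a single affine map, out of the product of the blocks of its arguments;
-- its linear part then splits over the coordinates.
Product : ∀ {r} → (Fin r → AbelianHeap) → AbelianHeap
Product H = record
  { Carrier = ∀ i → H.Carrier i
  ; _≈_ = λ x y → ∀ i → H._≈_ i (x i) (y i)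
  ; isEquivalence = record
    { refl = λ i → H.≈-refl i ; sym = λ eq i → H.≈-sym i (eq i) ; trans = λ eq eq′ i → H.≈-trans i (eq i) (eq′ i) }
  ; D = λ x y z i → H.D i (x i) (y i) (z i)
  ; D-cong = λ x≈ y≈ z≈ i → H.D-cong i (x≈ i) (y≈ i) (z≈ i)
  ; D-xyy = λ x y i → H.D-xyy i (x i) (y i)
  ; D-yyx = λ x y i → H.D-yyx i (x i) (y i)
  ; D-medial = λ x₁ x₂ x₃ y₁ y₂ y₃ z₁ z₂ z₃ i → H.D-medial i (x₁ i) (x₂ i) (x₃ i) (y₁ i) (y₂ i) (y₃ i) (z₁ i) (z₂ i) (z₃ i)
  }
  where module H i = AbelianHeap (H i)

module InProduct {r : ℕ} (H : Fin r → AbelianHeap) (e : ∀ i → AbelianHeap.Carrier (H i)) where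
  private
    module H i = InHeap (H i) (e i)
    module Π = InHeap (Product H) e

  -- Composed with the i-th projection, this is the inclusion of the i-th factor as a direct
  -- summand.
  mask : Fin r → (∀ j → AbelianHeap.Carrier (H j)) → ∀ j → AbelianHeap.Carrier (H j)
  mask i x j = if ⌊ i ≟ j ⌋ then x j else e j

  sum-at : ∀ {n} (t : Fin n → Π.Carrier) j → Π.sum t j ≡ H.sum j (λ i → t i j)
  sum-at {zero}  t j = refl
  sum-at {suc n} t j = cong (H.D j (t zero j) (e j)) (sum-at (t ∘ suc) j)

  ⋆-at : ∀ n (x : Π.Carrier) j → (n Π.⋆ x) j ≡ H._⋆_ j n (x j)
  ⋆-at zero    x j = refl
  ⋆-at (suc n) x j = cong (H.D j (x j) (e j)) (⋆-at n x j)

  -- If x j is the combination of the points c j with coefficients V j c, then the tuple x is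
  -- the combination of the tuples having one such point at one place and the base elsewhere.
  decompose : ∀ {k} (x : Π.Carrier) (pt : Fin k → Π.Carrier) (V : Fin r → Fin k → ℕ) →
    (∀ j → H._≈_ j (H.sum j (λ c → H._⋆_ j (V j c) (pt c j))) (x j)) →
    Π._≈_ x (Π.sum (λ i → Π.sum (λ c → V i c Π.⋆ mask i (pt c))))
  decompose {k} x pt V eq j = H.≈-sym j (begin
    Π.sum (λ i → Π.sum (λ c → V i c Π.⋆ mask i (pt c))) j  ≡⟨ sum-at (λ i → Π.sum (λ c → V i c Π.⋆ mask i (pt c))) j ⟩
    H.sum j (λ i → Π.sum (λ c → V i c Π.⋆ mask i (pt c)) j) ≈⟨ H.sum-cong-≋ j (λ i → H.≈-reflexive j (sum-at (λ c → V i c Π.⋆ mask i (pt c)) j)) ⟩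
    H.sum j (λ i → H.sum j (λ c → (V i c Π.⋆ mask i (pt c)) j)) ≈⟨ H.sum-cong-≋ j (λ i → H.sum-cong-≋ j λ c → H.≈-reflexive j (⋆-at (V i c) (mask i (pt c)) j)) ⟩
    H.sum j (λ i → H.sum j (λ c → H._⋆_ j (V i c) (mask i (pt c) j))) ≈⟨ H.sum-single j _ j off ⟩
    H.sum j (λ c → H._⋆_ j (V j c) (mask j (pt c) j))      ≈⟨ H.sum-cong-≋ j (λ c → H.×-congʳ j (V j c) (H.≈-reflexive j (on c))) ⟩
    H.sum j (λ c → H._⋆_ j (V j c) (pt c j))               ≈⟨ eq j ⟩
    x j                                                    ∎)
    where
    open import Relation.Binary.Reasoning.Setoid (H.setoid j)
    on : ∀ c → mask j (pt c) j ≡ pt c j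
    on c with j ≟ j
    ... | yes _  = refl
    ... | no j≢j = contradiction refl j≢j
    off : ∀ i → j ≢ i → H._≈_ j (H.sum j (λ c → H._⋆_ j (V i c) (mask i (pt c) j))) (e j)
    off i j≢i with i ≟ j
    ... | yes i≡j = contradiction (sym i≡j) j≢i
    ... | no _    = H.sum-zero j _ (λ c → H.⋆-zero j (V i c))

module Combination (H : AbelianHeap) (e : AbelianHeap.Carrier H) {k : ℕ} (point : Fin k → AbelianHeap.Carrier H) where
  open InHeap H e
  open import Relation.Binary.Reasoning.Setoid setoid

  comb : (Fin k → ℕ) → Carrier
  comb V = sum (λ c → V c ⋆ point c)

  comb-cong : ∀ {U V} → (∀ c → U c ≡ V c) → comb U ≈ comb V
  comb-cong U≗V = sum-cong-≋ (λ c → ≈-reflexive (cong (_⋆ point c) (U≗V c)))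

  comb-+ : ∀ U V → comb (λ c → U c + V c) ≈ comb U ∙ comb V
  comb-+ U V = ≈-trans (sum-cong-≋ (λ c → ×-homo-+ (point c) (U c) (V c))) (∑-distrib-+ (λ c → U c ⋆ point c) (λ c → V c ⋆ point c))

  comb-sumFin : ∀ {n} (U : Fin n → Fin k → ℕ) → comb (λ c → sumFin n (λ i → U i c)) ≈ sum (λ i → comb (U i))
  comb-sumFin {zero}  U = sum-zero (λ c → 0 ⋆ point c) (λ _ → ≈-refl)
  comb-sumFin {suc n} U = ≈-trans (comb-+ (U zero) _) (∙-congˡ (comb-sumFin (U ∘ suc)))

  comb-single : ∀ i {a} → point i ≈ a → ∀ n → comb (λ c → if ⌊ i ≟ c ⌋ then n else 0) ≈ n ⋆ a
  comb-single i {a} pt≈a n = ≈-trans (sum-single _ i off) on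
    where
    off : ∀ c → i ≢ c → (if ⌊ i ≟ c ⌋ then n else 0) ⋆ point c ≈ ε
    off c i≢c with i ≟ c
    ... | yes i≡c = contradiction i≡c i≢c
    ... | no _    = ≈-refl
    on : (if ⌊ i ≟ i ⌋ then n else 0) ⋆ point i ≈ n ⋆ a
    on with i ≟ i
    ... | yes _  = ×-congʳ n pt≈a
    ... | no i≢i = contradiction refl i≢i

  module _ {p : ℕ} {{_ : NonZero p}} (killed : ∀ a → p ⋆ a ≈ ε) where

    ⋆-% : ∀ n (a : Carrier) → (n % p) ⋆ a ≈ n ⋆ a
    ⋆-% n a = ≈-sym (begin
      n ⋆ a                                 ≡⟨ cong (_⋆ a) (m≡m%n+[m/n]*n n p) ⟩
      (n % p + n / p * p) ⋆ a               ≈⟨ ×-homo-+ a (n % p) (n / p * p) ⟩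
      (n % p) ⋆ a ∙ (n / p * p) ⋆ a         ≈⟨ ∙-congˡ (×-assocˡ a (n / p) p) ⟨
      (n % p) ⋆ a ∙ (n / p) ⋆ (p ⋆ a)       ≈⟨ ∙-congˡ (×-congʳ (n / p) (killed a)) ⟩
      (n % p) ⋆ a ∙ (n / p) ⋆ ε             ≈⟨ ∙-congˡ (⋆-zero (n / p)) ⟩
      (n % p) ⋆ a ∙ ε                       ≈⟨ identityʳ ((n % p) ⋆ a) ⟩
      (n % p) ⋆ a                           ∎)

    comb-% : ∀ {U V} → (∀ c → U c ≡ V c % p) → comb U ≈ comb V
    comb-% {U} {V} U≡ = sum-cong-≋ (λ c → ≈-trans (≈-reflexive (cong (_⋆ point c) (U≡ c))) (⋆-% (V c) (point c)))

module OperationOnCombinations {r k : ℕ} (H : Fin r → AbelianHeap) (e : ∀ i → AbelianHeap.Carrier (H i))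
  (K : AbelianHeap) (e′ : AbelianHeap.Carrier K) (h : Hom (Product H) K)
  (point : ∀ i → Fin k → AbelianHeap.Carrier (H i)) (point′ : Fin k → AbelianHeap.Carrier K)
  (index : AbelianHeap.Carrier K → Fin k) (point-index : ∀ a → AbelianHeap._≈_ K (point′ (index a)) a) where

  open Linearise h e e′
  open InProduct H e
  open Hom h
  private
    module Π = InHeap (Product H) e
    module K = InHeap K e′
    module C = Combination K e′ point′
    tuple : Fin r → Fin k → Π.Carrier
    tuple i c = mask i (λ j → point j c)

  image : Fin r → Fin k → K.Carrier
  image i c = linear (tuple i c)

  -- The constant term adds 1 at its own generator. Each pair (i , c) passes its coefficient on to
  -- the generator that represents the image of the c-th point in argument i. Only sums of entries
  -- of V occur.
  coeff : (Fin r → Fin k → ℕ) → Fin k → ℕ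
  coeff V c′ = (if ⌊ index (fun e) ≟ c′ ⌋ then 1 else 0) +
    sumFin r (λ i → sumFin k (λ c → if ⌊ index (image i c) ≟ c′ ⌋ then V i c else 0))

  comb-coeff : (V : Fin r → Fin k → ℕ) (x : Π.Carrier) →
    (∀ i → AbelianHeap._≈_ (H i) (Combination.comb (H i) (e i) (point i) (V i)) (x i)) →
    C.comb (coeff V) K.≈ fun x
  comb-coeff V x eq = begin
    C.comb (coeff V)
      ≈⟨ C.comb-+ (λ c′ → if ⌊ index (fun e) ≟ c′ ⌋ then 1 else 0) (λ c′ → sumFin r (λ i → sumFin k (λ c → part i c c′))) ⟩
    C.comb (λ c′ → if ⌊ index (fun e) ≟ c′ ⌋ then 1 else 0) K.∙ C.comb (λ c′ → sumFin r (λ i → sumFin k (λ c → part i c c′)))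
      ≈⟨ K.∙-cong (K.≈-trans (C.comb-single (index (fun e)) (point-index (fun e)) 1) (K.×-homo-1 (fun e)))
                  (C.comb-sumFin (λ i c′ → sumFin k (λ c → part i c c′))) ⟩
    fun e K.∙ K.sum (λ i → C.comb (λ c′ → sumFin k (λ c → part i c c′)))
      ≈⟨ K.∙-congˡ (K.sum-cong-≋ λ i → K.≈-trans (C.comb-sumFin (part i)) (K.sum-cong-≋ λ c →
           K.≈-trans (C.comb-single (index (image i c)) (point-index (image i c)) (V i c)) (K.≈-sym (linear-⋆ (V i c) (tuple i c))))) ⟩
    fun e K.∙ K.sum (λ i → K.sum (λ c → linear (V i c Π.⋆ tuple i c)))
      ≈⟨ K.∙-congˡ (K.≈-trans (K.sum-cong-≋ λ i → K.≈-sym (linear-sum (λ c → V i c Π.⋆ tuple i c)))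
           (K.≈-sym (linear-sum (λ i → Π.sum (λ c → V i c Π.⋆ tuple i c))))) ⟩
    fun e K.∙ linear (Π.sum (λ i → Π.sum (λ c → V i c Π.⋆ tuple i c)))
      ≈⟨ K.∙-congˡ (linear-cong (decompose x (λ c j → point j c) V eq)) ⟨
    fun e K.∙ linear x
      ≈⟨ K.comm (fun e) (linear x) ⟩
    linear x K.∙ fun e
      ≈⟨ fun≈linear x ⟨
    fun x ∎
    where
    open import Relation.Binary.Reasoning.Setoid K.setoid
    part : Fin r → Fin k → Fin k → ℕ
    part i c c′ = if ⌊ index (image i c) ≟ c′ ⌋ then V i c else 0

-- Congruences and the derived series

Exhaustible : Set → Set₁
Exhaustible X = ∀ {P : X → Set} → (∀ x → Dec (P x)) → Dec (∀ x → P x)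

bool-exhaustible : Exhaustible Bool
bool-exhaustible P? = map′ (λ { (t , f) → λ { true → t ; false → f } }) (λ h → h true , h false)
  (P? true ×-dec P? false)

vec-exhaustible : ∀ {X} → Exhaustible X → ∀ n → Exhaustible (Vec X n)
vec-exhaustible all zero    P? = map′ (λ { p []ᵛ → p }) (λ h → h []ᵛ) (P? []ᵛ)
vec-exhaustible all (suc n) P? = map′ (λ { h (x ∷ᵛ xs) → h x xs }) (λ h x xs → h (x ∷ᵛ xs))
  (all (λ x → vec-exhaustible all n (λ xs → P? (x ∷ᵛ xs))))

cong₃ : ∀ {X Y : Set} (g : X → X → X → Y) {a a′ b b′ c c′} → a ≡ a′ → b ≡ b′ → c ≡ c′ → g a b c ≡ g a′ b′ c′
cong₃ g refl refl refl = refl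

module Congruences (A : FinAlgebra)
  (op-ext : ∀ f {a b} → a ≗ b → FinAlgebra.op A f a ≡ FinAlgebra.op A f b)
  (malcev : IsMalcev A) where

  open FinAlgebra A

  d : Term A (Fin 3)
  d = proj₁ malcev

  D : Fin k → Fin k → Fin k → Fin k
  D x y z = evalTerm A d (lookup (x ∷ᵛ y ∷ᵛ z ∷ᵛ []ᵛ))

  D-xyy : ∀ x y → D x y y ≡ x
  D-xyy x y = proj₁ (proj₂ malcev x y)

  D-yyx : ∀ x y → D y y x ≡ x
  D-yyx x y = proj₂ (proj₂ malcev x y)

  Compatible : Rel A → Set
  Compatible R = ∀ f (a b : Fin (arity f) → Fin k) → (∀ i → R (a i) (b i)) → R (op f a) (op f b)

  module _ {R : Rel A} (compat : Compatible R) where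

    term-compat : ∀ {V} (t : Term A V) {a b : V → Fin k} → (∀ v → R (a v) (b v)) →
      R (evalTerm A t a) (evalTerm A t b)
    term-compat (var v)    ab = ab v
    term-compat (app f ts) ab = compat f _ _ (λ i → term-compat (ts i) ab)

    D-compat : ∀ {x x′ y y′ z z′} → R x x′ → R y y′ → R z z′ → R (D x y z) (D x′ y′ z′)
    D-compat xx′ yy′ zz′ = term-compat d λ { zero → xx′ ; (suc zero) → yy′ ; (suc (suc zero)) → zz′ }

    -- In a Malcev algebra a reflexive compatible relation is already a congruence: D applied to the
    -- pairs (x,x), (x,y), (y,y) gives (y,x), and `malcev-trans` is similar. So for `torsionCong`
    -- only reflexivity and compatibility need work.
    malcev-sym : (∀ x → R x x) → ∀ x y → R x y → R y x
    malcev-sym reflexive x y xy = subst₂ R (D-yyx y x) (D-xyy x y)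
      (D-compat (reflexive x) xy (reflexive y))

    malcev-trans : (∀ x → R x x) → ∀ x y z → R x y → R y z → R x z
    malcev-trans reflexive x y z xy yz = subst₂ R (D-xyy x y) (D-yyx z y)
      (D-compat xy (reflexive y) yz)

  term-ext : ∀ {V} (t : Term A V) {a b : V → Fin k} → a ≗ b → evalTerm A t a ≡ evalTerm A t b
  term-ext = term-compat {R = _≡_} (λ f a b → op-ext f)

  record Cong : Set where
    field
      rel    : Fin k → Fin k → Bool
      isCong : IsCong A rel

    _∼_ : Rel A
    x ∼ y = T (rel x y)

    setoid : Setoid 0ℓ 0ℓ
    setoid = record
      { _≈_ = _∼_
      ; isEquivalence = record
        { refl = proj₁ isCong _ ; sym = proj₁ (proj₂ isCong) _ _ ; trans = proj₁ (proj₂ (proj₂ isCong)) _ _ _ }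
      }

    open Setoid setoid public using (reflexive) renaming (refl to ∼-refl; sym to ∼-sym; trans to ∼-trans)

    compat : Compatible _∼_
    compat = proj₂ (proj₂ (proj₂ isCong))

    D-xxx : ∀ {x y z} → x ∼ y → x ∼ z → D x y z ∼ x
    D-xxx {x} xy xz = ∼-trans (D-compat {R = _∼_} compat ∼-refl (∼-sym xy) (∼-sym xz)) (reflexive (D-xyy x x))

  open Cong using (rel)

  -- The basic operations commute with D, hence are affine, on α-blocks modulo β. Unlike `TC`, which
  -- ranges over all terms, this is a finite condition.
  Abelian : (α β : Fin k → Fin k → Bool) → Set
  Abelian α β = ∀ f (x y z : Fin (arity f) → Fin k) →
    (∀ i → T (α (x i) (y i))) → (∀ i → T (α (y i) (z i))) →
    T (β (op f (λ i → D (x i) (y i) (z i))) (D (op f x) (op f y) (op f z)))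

  module _ (α β : Cong) (ab : Abelian (rel α) (rel β)) where
    private
      module α = Cong α
      module β = Cong β

    -- For the term `d` itself this is the medial law, from which all group laws on a block follow.
    abelian-term : ∀ {V} (t : Term A V) (x y z : V → Fin k) →
      (∀ v → x v α.∼ y v) → (∀ v → y v α.∼ z v) →
      evalTerm A t (λ v → D (x v) (y v) (z v)) β.∼ D (evalTerm A t x) (evalTerm A t y) (evalTerm A t z)
    abelian-term (var v)    x y z xy yz = β.∼-refl
    abelian-term (app f ts) x y z xy yz = β.∼-trans
      (β.compat f _ _ (λ i → abelian-term (ts i) x y z xy yz))
      (ab f _ _ _ (λ i → term-compat {R = α._∼_} α.compat (ts i) xy) (λ i → term-compat {R = α._∼_} α.compat (ts i) yz))

    block : Fin k → AbelianHeap
    block e = record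
      { Carrier = Σ (Fin k) (e α.∼_)
      ; _≈_ = λ x y → proj₁ x β.∼ proj₁ y
      ; isEquivalence = record { refl = β.∼-refl ; sym = β.∼-sym ; trans = β.∼-trans }
      ; D = λ (x , ex) (y , ey) (z , ez) → D x y z ,
          α.∼-trans ex (α.∼-sym (α.D-xxx (α.∼-trans (α.∼-sym ex) ey) (α.∼-trans (α.∼-sym ex) ez)))
      ; D-cong = D-compat {R = β._∼_} β.compat
      ; D-xyy = λ x y → β.reflexive (D-xyy (proj₁ x) (proj₁ y))
      ; D-yyx = λ x y → β.reflexive (D-yyx (proj₁ x) (proj₁ y))
      ; D-medial = λ (x₁ , ex₁) (x₂ , ex₂) (x₃ , ex₃) (y₁ , ey₁) (y₂ , ey₂) (y₃ , ey₃) (z₁ , ez₁) (z₂ , ez₂) (z₃ , ez₃) →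
          β.∼-sym (β.∼-trans
            (β.reflexive (term-ext d λ { zero → refl ; (suc zero) → refl ; (suc (suc zero)) → refl }))
            (abelian-term d (lookup (x₁ ∷ᵛ x₂ ∷ᵛ x₃ ∷ᵛ []ᵛ)) (lookup (y₁ ∷ᵛ y₂ ∷ᵛ y₃ ∷ᵛ []ᵛ)) (lookup (z₁ ∷ᵛ z₂ ∷ᵛ z₃ ∷ᵛ []ᵛ))
              (λ { zero → α.∼-trans (α.∼-sym ex₁) ey₁ ; (suc zero) → α.∼-trans (α.∼-sym ex₂) ey₂ ; (suc (suc zero)) → α.∼-trans (α.∼-sym ex₃) ey₃ })
              (λ { zero → α.∼-trans (α.∼-sym ey₁) ez₁ ; (suc zero) → α.∼-trans (α.∼-sym ey₂) ez₂ ; (suc (suc zero)) → α.∼-trans (α.∼-sym ey₃) ez₃ })))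
      }

  -- The search runs over vectors of arguments. A function agrees with its tabulation only
  -- pointwise, and `op-ext` bridges the gap.
  isCong? : ∀ δ → Dec (IsCong A δ)
  isCong? δ =
    all? (λ x → T? (δ x x))
    ×-dec all? (λ x → all? (λ y → T? (δ x y) →-dec T? (δ y x)))
    ×-dec all? (λ x → all? (λ y → all? (λ z → T? (δ x y) →-dec (T? (δ y z) →-dec T? (δ x z)))))
    ×-dec map′
      (λ h f a b ab → subst T (cong₂ δ (op-ext f (lookup∘tabulate a)) (op-ext f (lookup∘tabulate b)))
        (h f (tabulate a) (tabulate b) (λ i → subst T (sym (cong₂ δ (lookup∘tabulate a i) (lookup∘tabulate b i))) (ab i))))
      (λ h f a b ab → h f (lookup a) (lookup b) ab)
      (all? (λ f → vecs f (λ a → vecs f (λ b →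
        all? (λ i → T? (δ (lookup a i) (lookup b i))) →-dec T? (δ (op f (lookup a)) (op f (lookup b)))))))
    where
    vecs : ∀ f → Exhaustible (Vec (Fin k) (arity f))
    vecs f = vec-exhaustible all? (arity f)

  abelian? : ∀ α β → Dec (Abelian α β)
  abelian? α β = map′
    (λ h f x y z xy yz → subst T
      (cong₂ β (op-ext f (λ i → cong₃ D (lookup∘tabulate x i) (lookup∘tabulate y i) (lookup∘tabulate z i)))
               (cong₃ D (op-ext f (lookup∘tabulate x)) (op-ext f (lookup∘tabulate y)) (op-ext f (lookup∘tabulate z))))
      (h f (tabulate x) (tabulate y) (tabulate z)
        (λ i → subst T (sym (cong₂ α (lookup∘tabulate x i) (lookup∘tabulate y i))) (xy i))
        (λ i → subst T (sym (cong₂ α (lookup∘tabulate y i) (lookup∘tabulate z i))) (yz i))))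
    (λ h f x y z → h f (lookup x) (lookup y) (lookup z))
    (all? (λ f → vecs f (λ x → vecs f (λ y → vecs f (λ z →
      all? (λ i → T? (α (lookup x i) (lookup y i))) →-dec (all? (λ i → T? (α (lookup y i) (lookup z i))) →-dec
      T? (β (op f (λ i → D (lookup x i) (lookup y i) (lookup z i))) (D (op f (lookup x)) (op f (lookup y)) (op f (lookup z))))))))))
    where
    vecs : ∀ f → Exhaustible (Vec (Fin k) (arity f))
    vecs f = vec-exhaustible all? (arity f)

  Candidate : (α δ : Fin k → Fin k → Bool) → Set
  Candidate α δ = IsCong A δ × Abelian α δ

  candidate-resp : ∀ {α δ δ′} → (∀ x y → δ x y ≡ δ′ x y) → Candidate α δ → Candidate α δ′
  candidate-resp eq ((δ-refl , δ-sym , δ-trans , δ-compat) , ab) =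
    ( (λ x → to (δ-refl x))
    , (λ x y xy → to (δ-sym x y (from xy)))
    , (λ x y z xy yz → to (δ-trans x y z (from xy) (from yz)))
    , (λ f a b h → to (δ-compat f a b (λ i → from (h i)))))
    , (λ f x y z xy yz → to (ab f x y z xy yz))
    where
    to : ∀ {x y} → T _ → T _
    to {x} {y} = subst T (eq x y)
    from : ∀ {x y} → T _ → T _
    from {x} {y} = subst T (sym (eq x y))

  module _ (α : Cong) where
    private module α = Cong α

    Matrix : Set
    Matrix = Vec (Vec Bool k) k

    decode : Matrix → Fin k → Fin k → Bool
    decode M x y = lookup (lookup M x) y

    encode : (Fin k → Fin k → Bool) → Matrix
    encode δ = tabulate (λ x → tabulate (δ x))

    decode-encode : ∀ δ x y → δ x y ≡ decode (encode δ) x y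
    decode-encode δ x y = sym (trans (cong (λ v → lookup v y) (lookup∘tabulate (λ x → tabulate (δ x)) x)) (lookup∘tabulate (δ x) y))

    derived? : ∀ x y → Dec (∀ M → Candidate α.rel (decode M) → T (decode M x y))
    derived? x y = vec-exhaustible (vec-exhaustible bool-exhaustible k) k
      (λ M → (isCong? (decode M) ×-dec abelian? α.rel (decode M)) →-dec T? (decode M x y))

    -- derived is only Set-valued; the least congruence δ with Abelian α δ is computable, by intersecting
    -- over all Boolean matrices, and lies below it.
    derivedCong : Cong
    derivedCong = record
      { rel = λ x y → ⌊ derived? x y ⌋
      ; isCong =
          (λ x → fromWitness (λ M c → proj₁ (proj₁ c) x))
        , (λ x y xy → fromWitness (λ M c → proj₁ (proj₂ (proj₁ c)) x y (toWitness xy M c)))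
        , (λ x y z xy yz → fromWitness (λ M c → proj₁ (proj₂ (proj₂ (proj₁ c))) x y z (toWitness xy M c) (toWitness yz M c)))
        , (λ f a b ab → fromWitness (λ M c → proj₂ (proj₂ (proj₂ (proj₁ c))) f a b (λ i → toWitness (ab i) M c)))
      }

    derivedCong-abelian : Abelian α.rel (rel derivedCong)
    derivedCong-abelian f x y z xy yz = fromWitness (λ M c → proj₂ c f x y z xy yz)

    derivedCong-least : (δ : Cong) → Abelian α.rel (rel δ) → ∀ {x y} → T (rel derivedCong x y) → T (rel δ x y)
    derivedCong-least δ ab {x} {y} xy = subst T (sym (decode-encode (rel δ) x y))
      (toWitness xy (encode (rel δ)) (candidate-resp {α = α.rel} (decode-encode (rel δ)) (Cong.isCong δ , ab)))

    -- Makes α itself a candidate, so that `derivedCong` lies below α. Modulo α both sides collapse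
    -- to `op f x`.
    abelian-self : Abelian α.rel α.rel
    abelian-self f x y z xy yz = α.∼-trans
      (α.compat f _ _ (λ i → α.D-xxx (xy i) (α.∼-trans (xy i) (yz i))))
      (α.∼-sym (α.D-xxx (α.compat f x y xy) (α.compat f x z (λ i → α.∼-trans (xy i) (yz i)))))

  -- From the term condition to affine operations

  bind : ∀ {V W} → Term A V → (V → Term A W) → Term A W
  bind (var v)    σ = σ v
  bind (app f ts) σ = app f (λ i → bind (ts i) σ)

  eval-bind : ∀ {V W} (t : Term A V) (σ : V → Term A W) env →
    evalTerm A (bind t σ) env ≡ evalTerm A t (λ v → evalTerm A (σ v) env)
  eval-bind (var v)    σ env = refl
  eval-bind (app f ts) σ env = op-ext f (λ i → eval-bind (ts i) σ env)

  Dᵗ : ∀ {V} (t₁ t₂ t₃ : Term A V) → Term A V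
  Dᵗ t₁ t₂ t₃ = bind d (lookup (t₁ ∷ᵛ t₂ ∷ᵛ t₃ ∷ᵛ []ᵛ))

  eval-Dᵗ : ∀ {V} (t₁ t₂ t₃ : Term A V) env {x y z} →
    evalTerm A t₁ env ≡ x → evalTerm A t₂ env ≡ y → evalTerm A t₃ env ≡ z →
    evalTerm A (Dᵗ t₁ t₂ t₃) env ≡ D x y z
  eval-Dᵗ t₁ t₂ t₃ env refl refl refl = trans (eval-bind d _ env)
    (term-ext d λ { zero → refl ; (suc zero) → refl ; (suc (suc zero)) → refl })

  -- With T X Y = f (D (X i, y i, Y i)), the term S X Y = D (T x Y) (T X Y) (T X z) takes the value
  -- T x z on both sides when X = x, hence by the term condition also when X = y.
  module _ (R : Rel A) (R-refl : ∀ x → R x x) (δ : Cong) (tc : TC A R R (rel δ))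
    (α : Fin k → Fin k → Bool) (α⊆R : ∀ x y → T (α x y) → R x y) where
    private module δ = Cong δ

    TC⇒Abelian : Abelian α (rel δ)
    TC⇒Abelian f x y z xy yz = δ.∼-sym (subst₂ δ._∼_
        (trans (eval-S y y) (cong₃ D (op-ext f (λ i → D-xyy (x i) (y i))) (op-ext f (λ i → D-xyy (y i) (y i))) (op-ext f (λ i → D-yyx (z i) (y i)))))
        (trans (eval-S y z) (D-xyy (F x z) (F y z)))
        -- For X = y the term S takes the two sides of the required equation as values, at Y = y and
        -- at Y = z.
        (tc r (4 ℕ.* r) S x y (table y) (table z) (λ i → α⊆R _ _ (xy i)) rows
          (δ.reflexive (trans (trans (eval-S x y) (D-yyx (F x z) (F x y))) (sym (trans (eval-S x z) (D-xyy (F x z) (F x z))))))))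
      where
      r = arity f
      V = Fin r ⊎ Fin (4 ℕ.* r)

      -- Terms cannot name elements of the algebra, so x, y and z enter as further variables next to
      -- Y; they keep their values and are related by `R-refl`.
      column : (Fin r → Fin k) → Fin 4 → Fin r → Fin k
      column Y zero                   = Y
      column Y (suc zero)             = x
      column Y (suc (suc zero))       = y
      column Y (suc (suc (suc zero))) = z

      table : (Fin r → Fin k) → Fin (4 ℕ.* r) → Fin k
      table Y v = uncurry (column Y) (remQuot {4} r v)

      ‵X ‵Y ‵x ‵y ‵z : Fin r → Term A V
      ‵X i = var (inj₁ i)
      ‵Y i = var (inj₂ (combine {4} zero i))
      ‵x i = var (inj₂ (combine {4} (suc zero) i))
      ‵y i = var (inj₂ (combine {4} (suc (suc zero)) i))
      ‵z i = var (inj₂ (combine {4} (suc (suc (suc zero))) i))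

      ‵T : (X Y : Fin r → Term A V) → Term A V
      ‵T X Y = app f (λ i → Dᵗ (X i) (‵y i) (Y i))

      S : Term A V
      S = Dᵗ (‵T ‵x ‵Y) (‵T ‵X ‵Y) (‵T ‵X ‵z)

      F : (X Y : Fin r → Fin k) → Fin k
      F X Y = op f (λ i → D (X i) (y i) (Y i))

      rows : ∀ j → R (table y j) (table z j)
      rows j = columns (proj₁ (remQuot {4} r j)) (proj₂ (remQuot {4} r j))
        where
        columns : ∀ j i → R (column y j i) (column z j i)
        columns zero                   i = α⊆R _ _ (yz i)
        columns (suc zero)             i = R-refl _
        columns (suc (suc zero))       i = R-refl _
        columns (suc (suc (suc zero))) i = R-refl _

      table-at : ∀ Y j i → table Y (combine {4} j i) ≡ column Y j i
      table-at Y j i = cong (uncurry (column Y)) (remQuot-combine {4} j i)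

      eval-T : ∀ (X Y : Fin r → Term A V) {X′ Y′} {env : V → Fin k} →
        (∀ i → evalTerm A (X i) env ≡ X′ i) → (∀ i → evalTerm A (‵y i) env ≡ y i) → (∀ i → evalTerm A (Y i) env ≡ Y′ i) →
        evalTerm A (‵T X Y) env ≡ F X′ Y′
      eval-T X Y {env = env} eqX eqy eqY = op-ext f (λ i → eval-Dᵗ (X i) (‵y i) (Y i) env (eqX i) (eqy i) (eqY i))

      eval-S : ∀ X Y → evalTerm A S [ X , table Y ] ≡ D (F x Y) (F X Y) (F X z)
      eval-S X Y = eval-Dᵗ (‵T ‵x ‵Y) (‵T ‵X ‵Y) (‵T ‵X ‵z) [ X , table Y ]
        (eval-T ‵x ‵Y ats aty (table-at Y zero))
        (eval-T ‵X ‵Y (λ i → refl) aty (table-at Y zero))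
        (eval-T ‵X ‵z (λ i → refl) aty (table-at Y (suc (suc (suc zero)))))
        where
        ats = table-at Y (suc zero)
        aty = table-at Y (suc (suc zero))

  -- The derived series and its refinement by prime torsion

  top : Cong
  top = record { rel = λ _ _ → true ; isCong = (λ _ → tt) , (λ _ _ _ → tt) , (λ _ _ _ _ _ → tt) , (λ _ _ _ _ → tt) }

  derivedSeries : ℕ → Cong
  derivedSeries zero    = top
  derivedSeries (suc n) = derivedCong (derivedSeries n)

  derived-refl : ∀ n x → derived A n x x
  derived-refl zero    x = tt
  derived-refl (suc n) x δ cong _ = proj₁ cong x

  -- By induction the computable congruence is the smaller one, so the term condition for
  -- `derived n` applies to it. Every δ in the intersection defining `Comm` is therefore a candidate
  -- for `derivedCong`. Thus solvability forces the computable series down to equality.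
  derivedSeries⊆derived : ∀ n x y → T (rel (derivedSeries n) x y) → derived A n x y
  derivedSeries⊆derived zero    x y _  = tt
  derivedSeries⊆derived (suc n) x y xy δ cong tc =
    derivedCong-least (derivedSeries n) (record { rel = δ ; isCong = cong })
      (TC⇒Abelian (derived A n) (derived-refl n) (record { rel = δ ; isCong = cong }) tc
        (rel (derivedSeries n)) (derivedSeries⊆derived n)) xy

  -- multiple n e x is n · x in the group with zero e and addition D _ e _ on the block of e.
  multiple : ℕ → Fin k → Fin k → Fin k
  multiple zero    e x = e
  multiple (suc n) e x = D x e (multiple n e x)

  multiple-idem : ∀ n x → multiple n x x ≡ x
  multiple-idem zero    x = refl
  multiple-idem (suc n) x = trans (cong (D x x) (multiple-idem n x)) (D-xyy x x)

  multiple-compat : (β : Cong) → ∀ n {e e′ x x′} → T (rel β e e′) → T (rel β x x′) →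
    T (rel β (multiple n e x) (multiple n e′ x′))
  multiple-compat β zero    ee xx = ee
  multiple-compat β (suc n) ee xx = D-compat {R = Cong._∼_ β} (Cong.compat β) xx ee (multiple-compat β n ee xx)

  Torsion : ℕ → (α β : Cong) → Set
  Torsion p α β = ∀ x y → T (rel α x y) → T (rel β (multiple p x y) x)

  data Chain : Cong → Set where
    start : Chain top
    step  : ∀ {α β} p → Prime p → Abelian (rel α) (rel β) → Torsion p α β → Chain α → Chain β

  module _ (α β : Cong) (ab : Abelian (rel α) (rel β)) {e : Fin k} where
    open InHeap (block α β ab e) (e , Cong.∼-refl α) using (_⋆_; Carrier)

    ⋆≡multiple : ∀ n (y : Carrier) → proj₁ (n ⋆ y) ≡ multiple n e (proj₁ y)
    ⋆≡multiple zero    y = refl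
    ⋆≡multiple (suc n) y = cong (D (proj₁ y) e) (⋆≡multiple n y)

  module _ (α β : Cong) (β⊆α : ∀ {x y} → T (rel β x y) → T (rel α x y)) (ab : Abelian (rel α) (rel β)) where
    private
      module α = Cong α
      module β = Cong β

    -- `multiple` iterates D, with which operations commute. Its zeros move along from x to
    -- `op f x`, so no constant term appears.
    multiple-hom : ∀ n f (x y : Fin (arity f) → Fin k) → (∀ i → x i α.∼ y i) →
      op f (λ i → multiple n (x i) (y i)) β.∼ multiple n (op f x) (op f y)
    multiple-hom zero    f x y xy = β.∼-refl
    multiple-hom (suc n) f x y xy = β.∼-trans
      (ab f y x (λ i → multiple n (x i) (y i)) (λ i → α.∼-sym (xy i)) (λ i → α.∼-trans
        (α.reflexive (sym (multiple-idem n (x i)))) (multiple-compat α n α.∼-refl (xy i))))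
      (D-compat {R = β._∼_} β.compat β.∼-refl β.∼-refl (multiple-hom n f x y xy))

    -- In the groups of the α-blocks modulo β, relates x to all y with p (y − x) = 0.
    torsionCong : ℕ → Cong
    torsionCong p = record
      { rel = λ x y → α.rel x y ∧ β.rel (multiple p x y) x
      ; isCong = γ-refl , malcev-sym γ-compat γ-refl , malcev-trans γ-compat γ-refl , γ-compat
      }
      where
      open Equivalence
      γ-refl : ∀ x → T (α.rel x x ∧ β.rel (multiple p x x) x)
      γ-refl x = from T-∧ (α.∼-refl , β.reflexive (multiple-idem p x))
      γ-compat : Compatible (λ x y → T (α.rel x y ∧ β.rel (multiple p x y) x))
      γ-compat f a b ab′ = from T-∧
        ( α.compat f a b (λ i → proj₁ (to T-∧ (ab′ i)))
        , β.∼-trans (β.∼-sym (multiple-hom p f a b (λ i → proj₁ (to T-∧ (ab′ i)))))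
                    (β.compat f _ _ (λ i → proj₂ (to T-∧ (ab′ i)))))

    β⊆torsionCong : ∀ p {x y} → T (rel β x y) → T (rel (torsionCong p) x y)
    β⊆torsionCong p {x} {y} xy = Equivalence.from T-∧
      (β⊆α xy , β.∼-trans (multiple-compat β p β.∼-refl (β.∼-sym xy)) (β.reflexive (multiple-idem p x)))

    torsionCong⊆α : ∀ p {x y} → T (rel (torsionCong p) x y) → T (rel α x y)
    torsionCong⊆α p γxy = proj₁ (Equivalence.to T-∧ γxy)

    module _ {e : Fin k} where
      open InHeap (block α β ab e) (e , α.∼-refl)
        using (_⋆_; ×-homo-+; ×-homo-1; ×-assocˡ; Carrier; _∙_)

      -- Two of the k + 1 multiples of y by 0 to k coincide; cancelling the smaller leaves a
      -- positive multiple equal to zero.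
      finite-order : (y : Carrier) → ∃ λ n → 0 ℕ.< n × multiple n e (proj₁ y) β.∼ e
      finite-order y with pigeonhole (n<1+n k) (λ i → multiple (toℕ i) e (proj₁ y))
      ... | i , j , i<j , eq = toℕ j ∸ toℕ i , m<n⇒0<n∸m i<j , subst (β._∼ e) (⋆≡multiple α β ab (toℕ j ∸ toℕ i) y)
              (AbelianHeap.cancel (block α β ab e) {e , α.∼-refl} (toℕ i ⋆ y) ((toℕ j ∸ toℕ i) ⋆ y) same)
        where
        same : proj₁ ((toℕ i ⋆ y) ∙ ((toℕ j ∸ toℕ i) ⋆ y)) β.∼ proj₁ (toℕ i ⋆ y)
        same = β.∼-trans (β.∼-sym (×-homo-+ y (toℕ i) (toℕ j ∸ toℕ i)))
          (β.reflexive (trans (cong (λ n → proj₁ (n ⋆ y)) (m+[n∸m]≡n (<⇒≤ i<j)))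
            (trans (⋆≡multiple α β ab (toℕ j) y) (trans (sym eq) (sym (⋆≡multiple α β ab (toℕ i) y))))))

      -- As in Cauchy's theorem: strip the primes off an annihilating product one by one. When the
      -- remaining product no longer annihilates y, the multiple it gives is killed by the prime
      -- just removed.
      prime-order : (ps : List ℕ) → All Prime ps → (y : Carrier) → ¬ (proj₁ y β.∼ e) → proj₁ (product ps ⋆ y) β.∼ e →
        ∃ λ p → Prime p × Σ Carrier λ z → ¬ (proj₁ z β.∼ e) × proj₁ (p ⋆ z) β.∼ e
      prime-order [] [] y y≁e y∼e = contradiction (β.∼-trans (β.∼-sym (×-homo-1 y)) y∼e) y≁e
      prime-order (p ∷ ps) (p-prime ∷ primes) y y≁e y∼e with T? (β.rel (proj₁ (product ps ⋆ y)) e)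
      ... | yes z∼e = prime-order ps primes y y≁e z∼e
      ... | no  z≁e = p , p-prime , product ps ⋆ y , z≁e , β.∼-trans (×-assocˡ y p (product ps)) y∼e

    torsion-element : ∀ {e y} → T (α.rel e y) → ¬ T (β.rel y e) →
      ∃ λ p → Prime p × ∃ λ z → T (rel (torsionCong p) e z) × ¬ T (β.rel e z)
    torsion-element {e} {y} ey y≁e =
      let (n , 0<n , ny∼e) = finite-order (y , ey)
          fact = factorise n {{>-nonZero 0<n}}
          open PrimeFactorisation fact
          (p , p-prime , (z , ez) , z≁e , pz∼e) = prime-order factors factorsPrime (y , ey) y≁e
            (subst (λ n → T (β.rel n e)) (trans (sym (⋆≡multiple α β ab n (y , ey))) (cong (λ n → proj₁ (InHeap._⋆_ (block α β ab e) (e , α.∼-refl) n (y , ey))) isFactorisation)) ny∼e)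
      in p , p-prime , z , Equivalence.from T-∧ (ez , subst (λ n → T (β.rel n e)) (⋆≡multiple α β ab p (z , ez)) pz∼e) , (λ e∼z → z≁e (β.∼-sym e∼z))

  pairs : Cong → Subset (k ℕ.* k)
  pairs δ = tabulate (λ i → uncurry (rel δ) (remQuot k i))

  T⇒∈pairs : ∀ δ x y → T (rel δ x y) → combine x y ∈ pairs δ
  T⇒∈pairs δ x y xy = lookup⇒[]= (combine x y) (pairs δ) (trans (trans (lookup∘tabulate _ (combine x y))
    (cong (uncurry (rel δ)) (remQuot-combine x y))) (T⇒≡true xy))
    where
    T⇒≡true : ∀ {b} → T b → b ≡ true
    T⇒≡true {true} _ = refl

  ∈pairs⇒T : ∀ δ i → i ∈ pairs δ → T (uncurry (rel δ) (remQuot k i))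
  ∈pairs⇒T δ i i∈ = subst T (sym (trans (sym (lookup∘tabulate _ i)) ([]=⇒lookup i∈))) tt

  -- Splits an abelian step from below. If β is smaller than α, some element of prime order p exists
  -- modulo β, and `torsionCong` p lies strictly above β and still within α. The step down to β is
  -- then p-torsion, and the recursion treats the step from α to the larger congruence; it ends
  -- because the set of related pairs grows.
  refine : (α β : Cong) → (∀ {x y} → T (rel β x y) → T (rel α x y)) → Abelian (rel α) (rel β) →
    Chain α → Acc _⊃_ (pairs β) → Chain β
  refine α β β⊆α ab chain (acc rec) with any? (λ x → any? (λ y → T? (rel α x y) ×-dec ¬? (T? (rel β y x))))
  -- Here α and β relate the same pairs, so every multiple is trivial and any prime would serve.
  ... | no none = step 2 prime[2] ab (λ x y xy → β.∼-trans
          (multiple-compat β 2 β.∼-refl (decidable-stable (T? (rel β y x)) (λ y≁x → none (x , y , xy , y≁x))))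
          (β.reflexive (multiple-idem 2 x))) chain
    where module β = Cong β
  ... | yes (x , y , xy , y≁x) =
    let (p , p-prime , z , γxz , x≁z) = torsion-element α β β⊆α ab xy y≁x
        γ = torsionCong α β β⊆α ab p
        β⊆γ = β⊆torsionCong α β β⊆α ab p
        γ⊆α = torsionCong⊆α α β β⊆α ab p
    in step p p-prime (λ f a b c ab′ bc′ → ab f a b c (λ i → γ⊆α (ab′ i)) (λ i → γ⊆α (bc′ i)))
         (λ u v γuv → proj₂ (Equivalence.to T-∧ γuv))
         (refine α γ γ⊆α (λ f a b c ab′ bc′ → β⊆γ (ab f a b c ab′ bc′)) chain
           (rec ((λ {i} i∈ → subst (_∈ pairs γ) (combine-remQuot {k} k i) (T⇒∈pairs γ _ _ (β⊆γ (∈pairs⇒T β i i∈))))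
                , combine x z , T⇒∈pairs γ x z γxz
                , λ xz∈ → x≁z (subst (λ q → T (uncurry (rel β) q)) (remQuot-combine x z) (∈pairs⇒T β _ xz∈)))))

  derivedSeries-chain : ∀ n → Chain (derivedSeries n)
  derivedSeries-chain zero    = start
  derivedSeries-chain (suc n) = refine α (derivedCong α)
    (derivedCong-least α α (abelian-self α)) (derivedCong-abelian α) (derivedSeries-chain n) (⊃-wellFounded _)
    where α = derivedSeries n

-- A congruence relates the results of an operation on pointwise equal arguments, by reflexivity and
-- compatibility. The pair thus lies in every commutator, and solvability turns it into an equality.
solvable⇒op-ext : (A : FinAlgebra) → IsSolvable A →
  ∀ f {a b} → a ≗ b → FinAlgebra.op A f a ≡ FinAlgebra.op A f b
solvable⇒op-ext A (zero  , sol) f a≗b = sol _ _ tt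
solvable⇒op-ext A (suc n , sol) f {a} {b} a≗b = sol _ _ λ δ (δ-refl , _ , _ , δ-compat) _ →
  δ-compat f a b (λ i → subst (λ y → T (δ (a i) y)) (a≗b i) (δ-refl (a i)))

-- Polynomial bounds

-- With base n + 1 the powers are monotone in the exponent also at n = 0, so closure under sums and
-- products is immediate.
Poly : (ℕ → ℕ) → Set
Poly f = ∃ λ a → ∃ λ b → ∀ n → f n ≤ a * suc n ^ b

poly-≤ : ∀ {f g} → (∀ n → f n ≤ g n) → Poly g → Poly f
poly-≤ f≤g (a , b , g≤) = a , b , λ n → ≤-trans (f≤g n) (g≤ n)

poly-const : ∀ c → Poly (λ _ → c)
poly-const c = c , 0 , λ n → ≤-reflexive (sym (*-identityʳ c))

poly-id : Poly (λ n → n)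
poly-id = 1 , 1 , λ n → ≤-trans (m≤n+m n 1) (≤-reflexive (sym (trans (*-identityˡ _) (*-identityʳ (suc n)))))

poly-+ : ∀ {f g} → Poly f → Poly g → Poly (λ n → f n + g n)
poly-+ {f} {g} (a , b , f≤) (a′ , b′ , g≤) = a + a′ , b + b′ , λ n → begin
  f n + g n                                        ≤⟨ +-mono-≤ (f≤ n) (g≤ n) ⟩
  a * suc n ^ b + a′ * suc n ^ b′                  ≤⟨ +-mono-≤ (*-monoʳ-≤ a (^-monoʳ-≤ (suc n) (m≤m+n b b′))) (*-monoʳ-≤ a′ (^-monoʳ-≤ (suc n) (m≤n+m b′ b))) ⟩
  a * suc n ^ (b + b′) + a′ * suc n ^ (b + b′)     ≡⟨ solve 3 (λ a a′ x → a :* x :+ a′ :* x := (a :+ a′) :* x) refl a a′ (suc n ^ (b + b′)) ⟩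
  (a + a′) * suc n ^ (b + b′)                      ∎
  where
  open ≤-Reasoning
  open +-*-Solver

poly-* : ∀ {f g} → Poly f → Poly g → Poly (λ n → f n * g n)
poly-* {f} {g} (a , b , f≤) (a′ , b′ , g≤) = a * a′ , b + b′ , λ n → begin
  f n * g n                                ≤⟨ *-mono-≤ (f≤ n) (g≤ n) ⟩
  a * suc n ^ b * (a′ * suc n ^ b′)        ≡⟨ solve 4 (λ a x a′ y → a :* x :* (a′ :* y) := a :* a′ :* (x :* y)) refl a (suc n ^ b) a′ (suc n ^ b′) ⟩
  a * a′ * (suc n ^ b * suc n ^ b′)        ≡⟨ cong (a * a′ *_) (^-distribˡ-+-* (suc n) b b′) ⟨
  a * a′ * suc n ^ (b + b′)                ∎
  where
  open ≤-Reasoning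
  open +-*-Solver

PolyBounded⇒Poly : ∀ {f} → PolyBounded f → Poly f
PolyBounded⇒Poly (c , f≤) = c + c , c , λ n → ≤-trans (f≤ n) (begin
  c * n ^ c + c                        ≤⟨ +-mono-≤ (*-monoʳ-≤ c (^-monoˡ-≤ c (m≤n+m n 1))) (m≤m*n c (suc n ^ c) {{m^n≢0 (suc n) c}}) ⟩
  c * suc n ^ c + c * suc n ^ c        ≡⟨ solve 2 (λ c x → c :* x :+ c :* x := (c :+ c) :* x) refl c (suc n ^ c) ⟩
  (c + c) * suc n ^ c                  ∎)
  where
  open ≤-Reasoning
  open +-*-Solver

^-distribʳ-* : ∀ e m n → (m * n) ^ e ≡ m ^ e * n ^ e
^-distribʳ-* zero    m n = refl
^-distribʳ-* (suc e) m n = trans (cong (m * n *_) (^-distribʳ-* e m n))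
  (solve 4 (λ m n x y → m :* n :* (x :* y) := m :* x :* (n :* y)) refl m n (m ^ e) (n ^ e))
  where open +-*-Solver

-- For n > 0 use (n + 1)^b ≤ 2^b n^b.
Poly⇒PolyBounded : ∀ {f} → Poly f → PolyBounded f
Poly⇒PolyBounded {f} (a , b , f≤) = c , bound
  where
  open ≤-Reasoning
  open +-*-Solver
  c = a * 2 ^ b + b
  bound : ∀ n → f n ≤ c * n ^ c + c
  bound zero = begin
    f 0               ≤⟨ f≤ 0 ⟩
    a * 1 ^ b         ≤⟨ *-monoʳ-≤ a (^-monoˡ-≤ b (s≤s z≤n)) ⟩
    a * 2 ^ b         ≤⟨ m≤m+n (a * 2 ^ b) b ⟩
    c                 ≤⟨ m≤n+m c (c * 0 ^ c) ⟩
    c * 0 ^ c + c     ∎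
  bound n@(suc m) = begin
    f n                       ≤⟨ f≤ n ⟩
    a * suc n ^ b             ≤⟨ *-monoʳ-≤ a (^-monoˡ-≤ b (+-mono-≤ (s≤s z≤n) (≤-reflexive (sym (+-identityʳ n))))) ⟩
    a * (2 * n) ^ b           ≡⟨ cong (a *_) (^-distribʳ-* b 2 n) ⟩
    a * (2 ^ b * n ^ b)       ≡⟨ *-assoc a (2 ^ b) (n ^ b) ⟨
    a * 2 ^ b * n ^ b         ≤⟨ *-mono-≤ (m≤m+n (a * 2 ^ b) b) (^-monoʳ-≤ n (m≤n+m b (a * 2 ^ b))) ⟩
    c * n ^ c                 ≤⟨ m≤m+n (c * n ^ c) c ⟩
    c * n ^ c + c             ∎

poly-gateBound : ∀ {w M} → Poly w → Poly M → Poly (λ n → gateBound (w n) (M n))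
poly-gateBound pw pM = poly-+ pw (poly-+ (poly-+ (poly-const 2) pM)
  (poly-* (poly-+ (poly-const 1) pM) (poly-+ (poly-+ (poly-const 1) pM) (poly-const 2))))

-- Values as combinations of elements of a block

-- The second argument witnesses that `Fin k` is inhabited. The result depends on h alone, which is
-- why related elements get the same representative.
choose : ∀ {k} → (Fin k → Bool) → Fin k → Fin k
choose {suc zero}    h _ = zero
choose {suc (suc k)} h _ = if h zero then zero else suc (choose (h ∘ suc) zero)

choose-T : ∀ {k} (h : Fin k → Bool) d x → T (h x) → T (h (choose h d))
choose-T {suc zero}    h d zero hx = hx
choose-T {suc (suc k)} h d x    hx with h zero in eq
... | true  = subst T (sym eq) tt
choose-T {suc (suc k)} h d zero    hx | false = contradiction (subst T eq hx) λ ()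
choose-T {suc (suc k)} h d (suc x) hx | false = choose-T (h ∘ suc) zero x hx

choose-cong : ∀ {k} {h h′ : Fin k → Bool} {d d′} → h ≗ h′ → choose h d ≡ choose h′ d′
choose-cong {suc zero}    eq = refl
choose-cong {suc (suc k)} eq =
  cong₂ (λ b j → if b then zero else suc j) (eq zero) (choose-cong (eq ∘ suc))

T-ext : ∀ {b b′} → (T b → T b′) → (T b′ → T b) → b ≡ b′
T-ext {true}  {true}  _ _ = refl
T-ext {true}  {false} f _ = contradiction (f tt) λ ()
T-ext {false} {true}  _ g = contradiction (g tt) λ ()
T-ext {false} {false} _ _ = refl

module Representation (A : FinAlgebra)
  (op-ext : ∀ f {a b} → a ≗ b → FinAlgebra.op A f a ≡ FinAlgebra.op A f b)
  (malcev : IsMalcev A) where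

  open FinAlgebra A
  open Congruences A op-ext malcev
  open Cong using (rel)

  rep : Cong → Fin k → Fin k
  rep δ x = choose (rel δ x) x

  module _ (δ : Cong) where
    open Cong δ hiding (rel)

    rep-∼ : ∀ x → x ∼ rep δ x
    rep-∼ x = choose-T (rel δ x) x x ∼-refl

    rep-cong : ∀ {x y} → x ∼ y → rep δ x ≡ rep δ y
    rep-cong xy = choose-cong λ z → T-ext (∼-trans (∼-sym xy)) (∼-trans xy)

  module Affine (α β : Cong) (ab : Abelian (rel α) (rel β)) where
    private
      module α = Cong α
      module β = Cong β

    Block : Fin k → AbelianHeap
    Block = block α β ab

    base : ∀ e → AbelianHeap.Carrier (Block e)
    base e = e , α.∼-refl

    -- Elements outside the block of e are replaced by the zero of the group.
    point : ∀ e → Fin k → AbelianHeap.Carrier (Block e)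
    point e c with T? (rel α e c)
    ... | yes ec = c , ec
    ... | no  _  = base e

    point-index : ∀ e (a : AbelianHeap.Carrier (Block e)) → proj₁ (point e (proj₁ a)) β.∼ proj₁ a
    point-index e (a , ea) with T? (rel α e a)
    ... | yes _  = β.∼-refl
    ... | no ¬ea = contradiction ea ¬ea

    module Comb e = Combination (Block e) (base e) (point e)

    comb : Fin k → (Fin k → ℕ) → Fin k
    comb e V = proj₁ (Comb.comb e V)

    comb-mod : ∀ {p} {{_ : NonZero p}} → Torsion p α β → ∀ e V → comb e (λ c → toℕ (V c mod p)) β.∼ comb e V
    comb-mod {p} tor e V = Comb.comb-% e killed (λ c → ModArith.toℕ-mod p (V c))
      where
      killed : ∀ a → proj₁ (InHeap._⋆_ (Block e) (base e) p a) β.∼ e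
      killed a = subst (β._∼ e) (sym (⋆≡multiple α β ab p a)) (tor e (proj₁ a) (proj₂ a))

    -- V is a vector of coefficients for y relative to the representative of its block.
    Denotes : (Fin k → ℕ) → Fin k → Set
    Denotes V y = comb (rep α y) V β.∼ y

    module Operation (f : Fin nOps) (ē : Fin (arity f) → Fin k) where

      e′ : Fin k
      e′ = rep α (op f ē)

      opHom : Hom (Product (λ i → Block (ē i))) (Block e′)
      opHom = record
        { fun = λ x → op f (proj₁ ∘ x) , α.∼-trans (α.∼-sym (rep-∼ α (op f ē))) (α.compat f _ _ (proj₂ ∘ x))
        ; fun-cong = λ x≈y → β.compat f _ _ x≈y
        ; fun-D = λ x y z → ab f _ _ _
            (λ i → α.∼-trans (α.∼-sym (proj₂ (x i))) (proj₂ (y i)))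
            (λ i → α.∼-trans (α.∼-sym (proj₂ (y i))) (proj₂ (z i)))
        }

      open OperationOnCombinations (λ i → Block (ē i)) (base ∘ ē) (Block e′) (base e′) opHom
        (λ i → point (ē i)) (point e′) proj₁ (point-index e′) public

    -- The coefficients depend on the arguments only through V and the representatives ē, which the
    -- known bits determine. The tuple ē is only pointwise equal to the representatives because it
    -- comes out of a decision tree.
    denotes-gate : ∀ f (x ē : Fin (arity f) → Fin k) (V : Fin (arity f) → Fin k → ℕ) →
      (∀ i → ē i ≡ rep α (x i)) → (∀ i → Denotes (V i) (x i)) → Denotes (Operation.coeff f ē V) (op f x)
    denotes-gate f x ē V ē≡ den = subst (λ e → comb e (Operation.coeff f ē V) β.∼ op f x)
      (rep-cong α (α.compat f ē x ē∼x))
      (Operation.comb-coeff f ē V (λ i → x i , ē∼x i)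
        (λ i → subst (λ e → comb e (V i) β.∼ x i) (sym (ē≡ i)) (den i)))
      where
      ē∼x : ∀ i → ē i α.∼ x i
      ē∼x i = subst (α._∼ x i) (sym (ē≡ i)) (α.∼-sym (rep-∼ α (x i)))

    denotes-point : ∀ y → Denotes (λ c → if ⌊ y ≟ c ⌋ then 1 else 0) y
    denotes-point y = β.∼-trans
      (Comb.comb-single (rep α y) y {y , y∈} (point-index (rep α y) (y , y∈)) 1)
      (InHeap.×-homo-1 (Block (rep α y)) (base (rep α y)) (y , y∈))
      where y∈ = α.∼-sym (rep-∼ α y)

    denotes-cong : ∀ {U V y} → U ≗ V → Denotes V y → Denotes U y
    denotes-cong {y = y} U≗V = β.∼-trans (Comb.comb-cong (rep α y) U≗V)

-- Simulation of algebra circuits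

1<2 : 1 < 2
1<2 = s≤s (s≤s z≤n)

size-bit : ∀ {B V} b → size {B} {V} (bit b) ≤ 1
size-bit true  = z≤n
size-bit false = ≤-refl

if-cong : ∀ {B V : Set} b (v : V) {β : B → Bool} {ν : V → ℕ} → ⟦ if b then vtx v else nought ⟧ β ν ≡ (if b then ν v else 0)
if-cong true  v = refl
if-cong false v = refl

module Simulation (A : FinAlgebra)
  (op-ext : ∀ f {a b} → a ≗ b → FinAlgebra.op A f a ≡ FinAlgebra.op A f b)
  (malcev : IsMalcev A) (ι : Bool → Fin (FinAlgebra.k A)) where

  open FinAlgebra A
  open Congruences A op-ext malcev
  open Cong using (rel)
  open Representation A op-ext malcev

  -- A layer carries, for each input and each node, the indicators of its value in A;
  -- for nodes the value is only known up to a congruence.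
  Bits : ℕ → ℕ → Set
  Bits n s = (Fin n ⊎ Fin s) × Fin k

  width : ℕ → ℕ → ℕ
  width n s = (n + s) * k

  enc : ∀ {n s} → Bits n s → Fin (width n s)
  enc (i , c) = combine (join _ _ i) c

  dec : ∀ {n s} → Fin (width n s) → Bits n s
  dec {n} i = map₁ (splitAt n) (remQuot k i)

  dec-enc : ∀ {n s} (i : Bits n s) → dec (enc i) ≡ i
  dec-enc {n} {s} (i , c) = trans (cong (map₁ (splitAt n)) (remQuot-combine (join n s i) c)) (cong (_, c) (splitAt-join n s i))

  value : ∀ {n s} → Circ A n s → (Fin n → Bool) → Fin s → Fin k
  value C b = evalCirc A C (ι ∘ b)

  spec : ∀ {n s} → Cong → Circ A n s → (Fin n → Bool) → Bits n s → Bool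
  spec δ C b (inj₁ j , c) = ⌊ ι (b j) ≟ c ⌋
  spec δ C b (inj₂ g , c) = ⌊ rep δ (value C b g) ≟ c ⌋

  Encodes : ∀ {n s ps} → Cong → Circ A n s → Net n ps (width n s) → Set
  Encodes δ C N = ∀ b i → evalNet N b i ≡ spec δ C b (dec i)

  encodes-enc : ∀ {n s ps} δ (C : Circ A n s) (N : Net n ps (width n s)) → Encodes δ C N →
    ∀ b i → evalNet N b (enc i) ≡ spec δ C b i
  encodes-enc δ C N e b i = trans (e b (enc i)) (cong (spec δ C b) (dec-enc i))

  module Step (α β : Cong) (ab : Abelian (rel α) (rel β)) (p : ℕ) (p-prime : Prime p) (tor : Torsion p α β) where
    open Affine α β ab

    instance
      p≢0 : NonZero p
      p≢0 = prime⇒nonZero p-prime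

    1<p : 1 < p
    1<p = nonTrivial⇒n>1 p {{prime⇒nonTrivial p-prime}}

    -- The tree branches over all tuples ē of representatives, and its leaf for ē is
    -- `Operation.coeff`. Its size depends on the algebra alone.
    coeffExpr : ∀ f → Fin k → Expr (Fin (arity f) × Fin k) (Fin (arity f) × Fin k)
    coeffExpr f c′ = muxes _,_ λ ē → bit ⌊ op f ē ≟ c′ ⌋ ⊞ sumE (λ i → sumE (λ c →
      if ⌊ proj₁ (Operation.image f ē i c) ≟ c′ ⌋ then vtx (i , c) else nought))

    ⟦coeffExpr⟧ : ∀ f c′ {x ν} (h : Fin (arity f) → Fin k) → (∀ i j → x (i , j) ≡ ⌊ h i ≟ j ⌋) →
      ⟦ coeffExpr f c′ ⟧ x ν ≡ Operation.coeff f (rebuild h) (λ i c → ν (i , c)) c′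
    ⟦coeffExpr⟧ f c′ h sel = trans (⟦muxes⟧ _,_ _ h sel) (cong₂ _+_ (⟦bit⟧ ⌊ op f (rebuild h) ≟ c′ ⌋)
      (trans (⟦sumE⟧ {k = arity f} _) (sumFin-cong {w = arity f} (λ i → trans (⟦sumE⟧ {k = k} _) (sumFin-cong {w = k} (λ c → if-cong ⌊ proj₁ (Operation.image f (rebuild h) i c) ≟ c′ ⌋ (i , c)))))))

    -- Bounds the vertices added per node: k for an input or a constant, and the sum for a gate of
    -- any operation.
    growth : ℕ
    growth = k + sumFin nOps (λ f → sumFin k (size ∘ coeffExpr f))

    nodeExt : ∀ {n s w m} → Node A n s → (Bits n s → Fin w) → (P : Prog p w m) → (Fin s × Fin k → Fin (suc m)) →
      Extension P (Fin k)
    nodeExt (input j)  e P φ = Compile.compileAll 1<p (λ c → e (inj₁ j , c)) P ⊥-elim (λ c → c · unit)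
    nodeExt (const a)  e P φ = Compile.compileAll 1<p ⊥-elim P ⊥-elim (λ c → bit ⌊ a ≟ c ⌋)
    nodeExt (gate f g) e P φ = Compile.compileAll 1<p (λ (i , c) → e (inj₂ (g i) , c)) P (λ (i , c) → φ (g i , c)) (coeffExpr f)

    open Extension

    nodeExt-size : ∀ {n s w m} (nd : Node A n s) e (P : Prog p w m) φ → m′ (nodeExt nd e P φ) ≤ growth + m
    nodeExt-size {m = m} (input j) e P φ =
      ≤-trans (≤-reflexive (Compile.compileAll-size 1<p (λ c → e (inj₁ j , c)) P ⊥-elim (λ c → c · unit)))
        (+-monoˡ-≤ m (≤-trans (sumFin-≤ {k} _ (λ c → ≤-refl)) (≤-trans (≤-reflexive (*-identityʳ k)) (m≤m+n k _))))
    nodeExt-size {m = m} (const a) e P φ =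
      ≤-trans (≤-reflexive (Compile.compileAll-size 1<p ⊥-elim P ⊥-elim (λ c → bit ⌊ a ≟ c ⌋)))
        (+-monoˡ-≤ m (≤-trans (sumFin-≤ {k} _ (λ c → size-bit ⌊ a ≟ c ⌋)) (≤-trans (≤-reflexive (*-identityʳ k)) (m≤m+n k _))))
    nodeExt-size {m = m} (gate f g) e P φ =
      ≤-trans (≤-reflexive (Compile.compileAll-size 1<p (λ (i , c) → e (inj₂ (g i) , c)) P (λ (i , c) → φ (g i , c)) (coeffExpr f)))
        (+-monoˡ-≤ m (≤-trans (summand-≤ (λ f → sumFin k (size ∘ coeffExpr f)) f) (m≤n+m _ k)))

    older : ∀ {n s} → Bits n s → Bits n (suc s)
    older = map₁ (Sum.map₂ suc)

    record Built (w s : ℕ) : Set where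
      field
        {verts} : ℕ
        program : Prog p w verts
        vertex  : Fin s × Fin k → Fin (suc verts)

    build : ∀ {n s w} → Circ A n s → (Bits n s → Fin w) → Built w s
    build nil         e = record { program = one ; vertex = λ () }
    build (snoc C nd) e =
      let R = build C (e ∘ older)
          X = nodeExt nd (e ∘ older) (Built.program R) (Built.vertex R) in record
      { program = prog X
      ; vertex = λ { (zero , c) → new X c ; (suc g , c) → old X (Built.vertex R (g , c)) } }

    build-size : ∀ {n s w} (C : Circ A n s) (e : Bits n s → Fin w) → Built.verts (build C e) ≤ s * growth
    build-size nil         e = ≤-refl
    build-size (snoc C nd) e =
      let R = build C (e ∘ older) in
      ≤-trans (nodeExt-size nd (e ∘ older) (Built.program R) (Built.vertex R)) (+-monoʳ-≤ growth (build-size C (e ∘ older)))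

    coeffs : ∀ {n s w} → Circ A n s → (Bits n s → Fin w) → (Fin w → Bool) → Fin s → Fin k → ℕ
    coeffs C e x g c = val (Built.program (build C e)) x (Built.vertex (build C e) (g , c))

    spec-older : ∀ {n s} (C : Circ A n s) nd b i → spec α (snoc C nd) b (older i) ≡ spec α C b i
    spec-older C nd b (inj₁ j , c) = refl
    spec-older C nd b (inj₂ g , c) = refl

    coeffs-denote : ∀ {n s w} (C : Circ A n s) (e : Bits n s → Fin w) x b → (∀ i → x (e i) ≡ spec α C b i) →
      ∀ g → Denotes (coeffs C e x g) (value C b g)
    coeffs-denote (snoc C nd) e x b enc≡ = λ
      { (suc g) → denotes-cong {y = value C b g} (λ c → old-val X x (Built.vertex R (g , c))) (ih g)
      ; zero → newest nd refl }
      where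
      e′ = e ∘ older
      R = build C e′
      X = nodeExt nd e′ (Built.program R) (Built.vertex R)
      enc≡′ : ∀ i → x (e′ i) ≡ spec α C b i
      enc≡′ i = trans (enc≡ (older i)) (spec-older C nd b i)
      ih = coeffs-denote C e′ x b enc≡′
      newest : ∀ nd′ → nd′ ≡ nd → Denotes (coeffs (snoc C nd) e x zero) (evalNode A nd (ι ∘ b) (value C b))
      newest (input j) refl = denotes-cong {y = ι (b j)} (λ c → begin
        coeffs (snoc C nd) e x zero c               ≡⟨ Compile.compileAll-val 1<p (λ c → e′ (inj₁ j , c)) (Built.program R) ⊥-elim (λ c → c · unit) x c ⟩
        [ x (e′ (inj₁ j , c)) ]? * 1                ≡⟨ *-identityʳ _ ⟩
        [ x (e′ (inj₁ j , c)) ]?                    ≡⟨ cong [_]? (enc≡′ (inj₁ j , c)) ⟩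
        [ ⌊ ι (b j) ≟ c ⌋ ]?                        ∎) (denotes-point (ι (b j)))
        where open ≡-Reasoning
      newest (const a) refl = denotes-cong {y = a} (λ c →
        trans (Compile.compileAll-val 1<p ⊥-elim (Built.program R) ⊥-elim (λ c → bit ⌊ a ≟ c ⌋) x c) (⟦bit⟧ ⌊ a ≟ c ⌋)) (denotes-point a)
      newest (gate f g) refl = denotes-cong {y = op f (value C b ∘ g)} (λ c →
        trans (Compile.compileAll-val 1<p (λ (i , c) → e′ (inj₂ (g i) , c)) (Built.program R) (λ (i , c) → Built.vertex R (g i , c)) (coeffExpr f) x c)
              (⟦coeffExpr⟧ f c (rep α ∘ value C b ∘ g) (λ i j → enc≡′ (inj₂ (g i) , j))))
        (denotes-gate f (value C b ∘ g) (rebuild (rep α ∘ value C b ∘ g)) (λ i → coeffs C e′ x (g i))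
          (rebuild-≗ (rep α ∘ value C b ∘ g)) (λ i → ih (g i)))

    -- The first new layer reveals the coefficients modulo p, the second one decodes them.
    Bits₂ : ℕ → ℕ → Set
    Bits₂ n s = Bits n s ⊎ (Fin s × (Fin k × Fin p))

    width₂ : ℕ → ℕ → ℕ
    width₂ n s = width n s + s * (k * p)

    enc₂ : ∀ {n s} → Bits₂ n s → Fin (width₂ n s)
    enc₂ {n} {s} = join (width n s) (s * (k * p)) ∘ Sum.map enc (λ (g , c , v) → combine g (combine c v))

    dec₂ : ∀ {n s} → Fin (width₂ n s) → Bits₂ n s
    dec₂ {n} {s} = Sum.map dec (λ i → map₂ (remQuot p) (remQuot (k * p) i)) ∘ splitAt (width n s)

    dec₂-enc₂ : ∀ {n s} (i : Bits₂ n s) → dec₂ (enc₂ i) ≡ i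
    dec₂-enc₂ {n} {s} (inj₁ i) = trans
      (cong (Sum.map dec _) (splitAt-join (width n s) (s * (k * p)) (inj₁ (enc i)))) (cong inj₁ (dec-enc i))
    dec₂-enc₂ {n} {s} (inj₂ (g , c , v)) = trans
      (cong (Sum.map dec _) (splitAt-join (width n s) (s * (k * p)) (inj₂ (combine g (combine c v)))))
      (cong inj₂ (trans (cong (map₂ (remQuot p)) (remQuot-combine g (combine c v))) (cong (g ,_) (remQuot-combine c v))))

    query : ∀ {n s} → Bits₂ n s → Expr (Bits n s) (Fin s × Fin k)
    query (inj₁ i)           = i · unit
    query (inj₂ (g , c , v)) = vtx (g , c)

    -- A coefficient leaves the layer in one-hot form, through one gate with a singleton acceptance
    -- set for each residue v.
    accept : ∀ {n s} → Bits₂ n s → Fin p → Bool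
    accept (inj₁ i)           = isOne
    accept (inj₂ (g , c , v)) = λ u → ⌊ u ≟ v ⌋

    query-size : ∀ {n s} (i : Bits₂ n s) → size (query i) ≤ 1
    query-size (inj₁ i)           = ≤-refl
    query-size (inj₂ (g , c , v)) = z≤n

    module _ {n s} (C : Circ A n s) where
      open Built (build C enc)

      gate₁ : Bits₂ n s → Gate p (width n s)
      gate₁ i = Compile.mkGate 1<p enc program vertex (query i) (accept i)

      gate₁-size : ∀ i → gateSize (gate₁ i) ≤ gateBound (width n s) (1 + s * growth)
      gate₁-size i = ≤-trans (Compile.gateSize-mkGate 1<p enc program vertex (query i) (accept i))
        (gateBound-mono (width n s) (+-mono-≤ (query-size i) (build-size C enc)))

    spec₂ : ∀ {n s} → Circ A n s → (Fin (width n s) → Bool) → Bits₂ n s → Bool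
    spec₂ C x (inj₁ i)           = x (enc i)
    spec₂ C x (inj₂ (g , c , v)) = ⌊ coeffs C enc x g c mod p ≟ v ⌋

    gate₁-out : ∀ {n s} (C : Circ A n s) i x → gateOut (gate₁ C i) x ≡ spec₂ C x i
    gate₁-out C i@(inj₁ j) x = trans (Compile.gateOut-mkGate 1<p enc _ (Built.vertex (build C enc)) (query i) (accept i) x)
      (trans (cong (λ v → isOne (v mod p)) (*-identityʳ [ x (enc j) ]?)) (isOne-bit 1<p (x (enc j))))
    gate₁-out C i@(inj₂ _) x = Compile.gateOut-mkGate 1<p enc _ (Built.vertex (build C enc)) (query i) (accept i) x

    -- Brute force over the block and all vectors of k residues, which is affordable since k and p
    -- are constants.
    decodeExpr : Fin k → Expr (Fin k ⊎ Fin k × Fin p) ⊥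
    decodeExpr a = mux inj₁ (λ e → muxes (λ c v → inj₂ (c , v)) (λ u → bit ⌊ rep β (comb e (toℕ ∘ u)) ≟ a ⌋))

    ⟦decodeExpr⟧ : ∀ a y V x → Denotes V y →
      (∀ e → x (inj₁ e) ≡ ⌊ rep α y ≟ e ⌋) → (∀ c v → x (inj₂ (c , v)) ≡ ⌊ V c mod p ≟ v ⌋) →
      ⟦ decodeExpr a ⟧ x ⊥-elim ≡ [ ⌊ rep β y ≟ a ⌋ ]?
    ⟦decodeExpr⟧ a y V x den x₁ x₂ = begin
      ⟦ decodeExpr a ⟧ x ⊥-elim
        ≡⟨ ⟦mux⟧ inj₁ _ (rep α y) x₁ ⟩
      ⟦ muxes (λ c v → inj₂ (c , v)) (λ u → bit ⌊ rep β (comb (rep α y) (toℕ ∘ u)) ≟ a ⌋) ⟧ x ⊥-elim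
        ≡⟨ ⟦muxes⟧ (λ c v → inj₂ (c , v)) _ (λ c → V c mod p) x₂ ⟩
      ⟦ bit ⌊ rep β (comb (rep α y) (toℕ ∘ u)) ≟ a ⌋ ⟧ x ⊥-elim
        ≡⟨ ⟦bit⟧ ⌊ rep β (comb (rep α y) (toℕ ∘ u)) ≟ a ⌋ ⟩
      [ ⌊ rep β (comb (rep α y) (toℕ ∘ u)) ≟ a ⌋ ]?
        ≡⟨ cong (λ z → [ ⌊ z ≟ a ⌋ ]?) (rep-cong β (β.∼-trans
             (Comb.comb-cong (rep α y) (λ c → cong toℕ (rebuild-≗ (λ c → V c mod p) c)))
             (β.∼-trans (comb-mod tor (rep α y) V) den))) ⟩
      [ ⌊ rep β y ≟ a ⌋ ]? ∎
      where
      module β = Cong β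
      u = rebuild (λ c → V c mod p)
      open ≡-Reasoning

    choice : ∀ {n s} → Fin s → Fin k ⊎ Fin k × Fin p → Fin (width₂ n s)
    choice {n} {s} g (inj₁ e) = enc₂ {n} {s} (inj₁ (inj₂ g , e))
    choice {n} {s} g (inj₂ q) = enc₂ {n} {s} (inj₂ (g , q))

    -- One-hot inputs let a single leaf survive, so the sums are 0 or 1 and the modulus 2 suffices.
    gate₂ : ∀ {n s} → Bits n s → Gate 2 (width₂ n s)
    gate₂ {n} {s} (inj₁ j , c) = mkGate one ⊥-elim (tt · unit) isOne
      where open Compile 1<2 {B = ⊤} (λ _ → enc₂ {n} {s} (inj₁ (inj₁ j , c)))
    gate₂ {n} {s} (inj₂ g , a) = mkGate one ⊥-elim (decodeExpr a) isOne
      where open Compile 1<2 (choice {n} {s} g)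

    decodeBound : ℕ
    decodeBound = 1 + sumFin k (size ∘ decodeExpr)

    gate₂-size : ∀ {n s} (i : Bits n s) → gateSize (gate₂ i) ≤ gateBound (width₂ n s) decodeBound
    gate₂-size {n} {s} (inj₁ j , c) = ≤-trans (gateSize-mkGate one ⊥-elim (tt · unit) isOne)
      (gateBound-mono (width₂ n s) (m≤m+n 1 _))
      where open Compile 1<2 {B = ⊤} (λ _ → enc₂ {n} {s} (inj₁ (inj₁ j , c)))
    gate₂-size {n} {s} (inj₂ g , a) = ≤-trans (gateSize-mkGate one ⊥-elim (decodeExpr a) isOne)
      (gateBound-mono (width₂ n s) (≤-trans (≤-reflexive (+-identityʳ _)) (≤-trans (summand-≤ (size ∘ decodeExpr) a) (m≤n+m _ 1))))
      where open Compile 1<2 (choice {n} {s} g)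

    gate₂-out : ∀ {n s} (C : Circ A n s) x x₂ b → (∀ i → x (enc i) ≡ spec α C b i) → (∀ i → x₂ (enc₂ i) ≡ spec₂ C x i) →
      ∀ i → gateOut (gate₂ i) x₂ ≡ spec β C b i
    gate₂-out {n} {s} C x x₂ b enc≡ enc₂≡ (inj₁ j , c) = trans (gateOut-mkGate one ⊥-elim (tt · unit) isOne x₂)
      (trans (cong (λ v → isOne (v mod 2)) (*-identityʳ [ x₂ (enc₂ {n} {s} (inj₁ (inj₁ j , c))) ]?))
      (trans (isOne-bit 1<2 _) (trans (enc₂≡ (inj₁ (inj₁ j , c))) (enc≡ (inj₁ j , c)))))
      where open Compile 1<2 {B = ⊤} (λ _ → enc₂ {n} {s} (inj₁ (inj₁ j , c)))
    gate₂-out {n} {s} C x x₂ b enc≡ enc₂≡ (inj₂ g , a) = trans (gateOut-mkGate one ⊥-elim (decodeExpr a) isOne x₂)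
      (trans (cong (λ v → isOne (v mod 2)) (trans (⟦⟧-cong (decodeExpr a) (λ ()))
        (⟦decodeExpr⟧ a (value C b g) (coeffs C enc x g) (x₂ ∘ choice {n} {s} g) (coeffs-denote C enc x b enc≡ g)
          (λ e → trans (enc₂≡ (inj₁ (inj₂ g , e))) (enc≡ (inj₂ g , e))) (λ c v → enc₂≡ (inj₂ (g , c , v))))))
      (isOne-bit 1<2 _))
      where open Compile 1<2 (choice {n} {s} g)

    module _ {n s q ps} (C : Circ A n s) (N : Net n (q ∷ ps) (width n s)) where

      decoders : Fin (width n s) → Gate 2 (width₂ n s)
      decoders i = gate₂ {n} {s} (dec i)

      readers : Fin (width₂ n s) → Gate p (width n s)
      readers i = gate₁ C (dec₂ i)

      newLayers : Net n (2 ∷ p ∷ q ∷ ps) (width n s)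
      newLayers = layer decoders (layer readers N)

      newLayers-encode : Encodes α C N → Encodes β C newLayers
      newLayers-encode e b i = gate₂-out C (evalNet N b) (evalNet (layer readers N) b) b (encodes-enc α C N e b)
        (λ j → trans (gate₁-out C (dec₂ (enc₂ j)) (evalNet N b)) (cong (spec₂ C (evalNet N b)) (dec₂-enc₂ j))) (dec i)

      newLayers-size : netSize newLayers ≤ width n s * gateBound (width₂ n s) decodeBound
                                   + (width₂ n s * gateBound (width n s) (1 + s * growth) + netSize N)
      newLayers-size = +-mono-≤ (sumFin-≤ (gateSize ∘ decoders) (λ i → gate₂-size {n} {s} (dec i)))
        (+-monoˡ-≤ (netSize N) (sumFin-≤ (gateSize ∘ readers) (λ i → gate₁-size C (dec₂ i))))

  -- The interpolation polynomial of h over GF(2): at b = 1 the two copies of h false cancel.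
  boolExpr : (Bool → Bool) → Expr ⊤ ⊥
  boolExpr h = bit (h false) ⊞ tt · (bit (h false) ⊞ bit (h true))

  boolExpr-size : ∀ h → size (boolExpr h) ≤ 6
  boolExpr-size h with h false | h true
  ... | true  | true  = m≤m+n 3 3
  ... | true  | false = m≤m+n 4 2
  ... | false | true  = m≤m+n 5 1
  ... | false | false = ≤-refl

  ⟦boolExpr⟧ : ∀ h b → isOne (⟦ boolExpr h ⟧ (λ _ → b) ⊥-elim mod 2) ≡ h b
  ⟦boolExpr⟧ h b with h false in f | h true in t
  ⟦boolExpr⟧ h true  | true  | true  = sym t
  ⟦boolExpr⟧ h true  | true  | false = sym t
  ⟦boolExpr⟧ h true  | false | true  = sym t
  ⟦boolExpr⟧ h true  | false | false = sym t
  ⟦boolExpr⟧ h false | true  | true  = sym f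
  ⟦boolExpr⟧ h false | true  | false = sym f
  ⟦boolExpr⟧ h false | false | true  = sym f
  ⟦boolExpr⟧ h false | false | false = sym f

  -- Modulo `top` all nodes share one representative, so their bits are constants; `ι true` is just
  -- an available element to compute it from.
  bottomGate : ∀ {n s} → Bits n s → Gate 2 n
  bottomGate (inj₁ j , c) = Compile.mkGate 1<2 (λ _ → j) one ⊥-elim (boolExpr (λ v → ⌊ ι v ≟ c ⌋)) isOne
  bottomGate (inj₂ g , c) = Compile.mkGate 1<2 {B = ⊥} ⊥-elim one ⊥-elim (bit ⌊ rep top (ι true) ≟ c ⌋) isOne

  bottomGate-size : ∀ {n s} (i : Bits n s) → gateSize (bottomGate i) ≤ gateBound n 6
  bottomGate-size {n} (inj₁ j , c) = ≤-trans (Compile.gateSize-mkGate 1<2 (λ _ → j) one ⊥-elim (boolExpr (λ v → ⌊ ι v ≟ c ⌋)) isOne)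
    (gateBound-mono n (≤-trans (≤-reflexive (+-identityʳ _)) (boolExpr-size (λ v → ⌊ ι v ≟ c ⌋))))
  bottomGate-size {n} (inj₂ g , c) = ≤-trans (Compile.gateSize-mkGate 1<2 {B = ⊥} ⊥-elim one ⊥-elim (bit ⌊ rep top (ι true) ≟ c ⌋) isOne)
    (gateBound-mono n (≤-trans (≤-reflexive (+-identityʳ _)) (≤-trans (size-bit ⌊ rep top (ι true) ≟ c ⌋) (m≤m+n 1 5))))

  bottomGate-out : ∀ {n s} (C : Circ A n s) i b → gateOut (bottomGate i) b ≡ spec top C b i
  bottomGate-out C (inj₁ j , c) b = trans (Compile.gateOut-mkGate 1<2 (λ _ → j) one ⊥-elim (boolExpr (λ v → ⌊ ι v ≟ c ⌋)) isOne b)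
    (trans (cong (λ v → isOne (v mod 2)) (⟦⟧-cong (boolExpr (λ v → ⌊ ι v ≟ c ⌋)) {ν′ = ⊥-elim} (λ ()))) (⟦boolExpr⟧ (λ v → ⌊ ι v ≟ c ⌋) (b j)))
  bottomGate-out C (inj₂ g , c) b = trans (Compile.gateOut-mkGate 1<2 {B = ⊥} ⊥-elim one ⊥-elim (bit ⌊ rep top (ι true) ≟ c ⌋) isOne b)
    (trans (cong (λ v → isOne (v mod 2)) (⟦bit⟧ ⌊ rep top (ι true) ≟ c ⌋))
    (trans (isOne-bit 1<2 ⌊ rep top (ι true) ≟ c ⌋) (cong (λ z → ⌊ z ≟ c ⌋) (rep-cong top {y = value C b g} tt))))

  -- The moduli are fixed before the circuit family. The net outputs the bits of all nodes, because
  -- the next layers need the block of each argument of each gate.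
  Realises : Cong → List ℕ → Set
  Realises δ ps = (s : ℕ → ℕ) (C : ∀ n → Circ A n (s n)) → Poly s →
    Σ ((n : ℕ) → Net n ps (width n (s n))) λ N → Poly (netSize ∘ N) × (∀ n → Encodes δ (C n) (N n))

  poly-width : ∀ {s} → Poly s → Poly (λ n → width n (s n))
  poly-width ps = poly-* (poly-+ poly-id ps) (poly-const k)

  realise-top : Realises top (2 ∷ [])
  realise-top s C ps = (λ n → bottom (bottomGate {n} {s n} ∘ dec)) ,
    poly-≤ (λ n → sumFin-≤ _ (λ i → bottomGate-size {n} {s n} (dec i))) (poly-* (poly-width ps) (poly-gateBound poly-id (poly-const 6))) ,
    (λ n b i → bottomGate-out (C n) (dec i) b)

  realise-step : ∀ {α β q ps} p (p-prime : Prime p) (ab : Abelian (rel α) (rel β)) → Torsion p α β →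
    Realises α (q ∷ ps) → Realises β (2 ∷ p ∷ q ∷ ps)
  realise-step {α} {β} p p-prime ab tor R s C poly-s with R s C poly-s
  ... | N , poly-N , N-encodes = (λ n → newLayers (C n) (N n)) ,
      poly-≤ (λ n → newLayers-size (C n) (N n))
        (poly-+ (poly-* poly-w (poly-gateBound poly-w₂ (poly-const decodeBound)))
        (poly-+ (poly-* poly-w₂ (poly-gateBound poly-w (poly-+ (poly-const 1) (poly-* poly-s (poly-const growth))))) poly-N)) ,
      (λ n → newLayers-encode (C n) (N n) (N-encodes n))
    where
    open Step α β ab p p-prime tor
    poly-w = poly-width poly-s
    poly-w₂ = poly-+ poly-w (poly-* poly-s (poly-const (k * p)))

  module _ (S : Fin k → Bool) {n s : ℕ} where

    output : Fin k → Fin (width n (suc s))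
    output c = enc {n} {suc s} (inj₂ zero , c)

    acceptGate : Gate 2 (width n (suc s))
    acceptGate = Compile.mkGate 1<2 output one ⊥-elim (mux id (λ c → bit (S c))) isOne

    acceptGate-size : gateSize acceptGate ≤ gateBound (width n (suc s)) (size (mux {V = ⊥} id (λ c → bit (S c))) + 0)
    acceptGate-size = Compile.gateSize-mkGate 1<2 output one ⊥-elim (mux id (λ c → bit (S c))) isOne

    acceptGate-out : ∀ {ps} δ (C : Circ A n (suc s)) (N : Net n ps (width n (suc s))) → Encodes δ C N → ∀ b →
      gateOut acceptGate (evalNet N b) ≡ S (rep δ (value C b zero))
    acceptGate-out δ C N e b =
      trans (Compile.gateOut-mkGate 1<2 output one ⊥-elim (mux id (λ c → bit (S c))) isOne (evalNet N b))
      (trans (cong (λ v → isOne (v mod 2)) (trans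
        (⟦mux⟧ id (λ c → bit (S c)) (rep δ (value C b zero)) (λ c → encodes-enc δ C N e b (inj₂ zero , c)))
        (⟦bit⟧ (S (rep δ (value C b zero))))))
      (isOne-bit 1<2 (S (rep δ (value C b zero)))))

  recognise : ∀ {δ q ps} → (∀ x y → T (rel δ x y) → x ≡ y) → Realises δ (q ∷ ps) →
    ∀ {L} S (t : ∀ n → Σ ℕ λ s → Circ A n (suc s)) → PolyBounded (λ n → suc (proj₁ (t n))) →
    (∀ n b → L n b ⇔ T (S (value (proj₂ (t n)) b zero))) → InNuDet (2 ∷ q ∷ ps) L
  recognise {δ} {q} {ps} δ⊆≡ R {L} S t bounded rec = net , Poly⇒PolyBounded net-size , correct
    where
    poly-s = PolyBounded⇒Poly bounded
    realised = R (suc ∘ proj₁ ∘ t) (proj₂ ∘ t) poly-s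
    N = proj₁ realised

    final : ∀ n → Gate 2 (width n (suc (proj₁ (t n))))
    final n = acceptGate S {n} {proj₁ (t n)}

    net : ∀ n → Net n (2 ∷ q ∷ ps) 1
    net n = layer (λ _ → final n) (N n)

    net-size : Poly (netSize ∘ net)
    net-size = poly-≤ (λ n → +-monoˡ-≤ (netSize (N n)) (sumFin-≤ {1} (λ _ → gateSize (final n)) (λ _ → acceptGate-size S {n} {proj₁ (t n)})))
      (poly-+ (poly-* (poly-const 1) (poly-gateBound (poly-width poly-s) (poly-const _))) (proj₁ (proj₂ realised)))

    correct : ∀ n b → L n b ⇔ T (gateOut (final n) (evalNet (N n) b))
    correct n b = subst (λ v → L n b ⇔ T v)
      -- As δ lies below equality, the representative is the value itself.
      (trans (cong S (δ⊆≡ y (rep δ y) (rep-∼ δ y))) (sym (acceptGate-out S δ (proj₂ (t n)) (N n) (proj₂ (proj₂ realised) n) b)))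
      (rec n b)
      where y = value (proj₂ (t n)) b zero

-- The primes are produced outside the quantifier over `ι`, since one sequence has to serve all
-- languages and hence all encodings of the input bits.
chain-primes : ∀ A op-ext malcev {δ} → Congruences.Chain A op-ext malcev δ → Σ ℕ λ q → Σ (List ℕ) λ ps → All Prime (q ∷ ps) ×
  (∀ ι → Simulation.Realises A op-ext malcev ι δ (q ∷ ps))
chain-primes A op-ext malcev Congruences.start = 2 , [] , prime[2] ∷ [] , λ ι → Simulation.realise-top A op-ext malcev ι
chain-primes A op-ext malcev (Congruences.step p p-prime ab tor chain) =
  let (q , ps , primes , R) = chain-primes A op-ext malcev chain in
  2 , p ∷ q ∷ ps , prime[2] ∷ p-prime ∷ primes , λ ι → Simulation.realise-step A op-ext malcev ι p p-prime ab tor (R ι)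

mainTheorem5 : (A : FinAlgebra) → IsMalcev A → IsSolvable A →
    Σ (List ℕ) λ ps → (ps ≢ []) × All Prime ps × (∀ (L : Lang) → InNuP A L → InNuDet ps L)
mainTheorem5 A malcev solvable@(r , trivial) =
  let op-ext = solvable⇒op-ext A solvable
      open Congruences A op-ext malcev
      (q , ps , primes , realises) = chain-primes A op-ext malcev (derivedSeries-chain r)
  in 2 ∷ q ∷ ps , (λ ()) , prime[2] ∷ primes , λ L (t , ι , S , bounded , recognises) →
    Simulation.recognise A op-ext malcev ι
      (λ x y xy → trivial x y (derivedSeries⊆derived r x y xy)) (realises ι) S t bounded recognises
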